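{- Let $K \subsetneq L$ be a field extension, and let $A$ and $B$ be two $n$-dimensional $K$-subspaces of $L$, with $0 < n < \infty$ and $1 \notin B$. Let $0 \leq d \leq n$ be an integer. Then $A$ is partially matched to $B$ with defect $d$ if and only if, for every pair of nonzero $K$-subspaces $S\subseteq A$ and $R\subseteq B \oplus K$ with $SR = S$, we have $$\dim S-d\leq \dim \big(B/(B\cap R)\big).$$
   Context: Fields are commutative. All dimensions are over $K$ unless indicated otherwise. $[n]=\{1,\dots,n\}$, and $\langle X\rangle$ denotes the $K$-span of a set $X$. For $K$-subspaces $S,R$ of $L$, $SR=\{sr : s\in S,\ r\in R\}$ is the Minkowski product (a set, not its span). All direct sums are internal; since $1\notin B$, the sum $B+K$ in $L$ is direct and is written $B\oplus K$. Definition (partial matching of bases). Let $A,B$ be $n$-dimensional $K$-subspaces of $L$, $n\ge 1$, and $0\le d\le n$ an integer. An ordered basis $\mathcal{A}=\{a_1,\dots,a_n\}$ of $A$ is partially matched to an ordered basis $\mathcal{B}=\{b_1,\dots,b_n\}$ of $B$ with defect $d$ if there exists $P\subseteq[n]$ with $|P|=n-d$ such that $$a_i^{ -1}A\cap B\subseteq \langle b_1,\dots,b_{i-1},b_{i+1},\dots,b_n\rangle\quad\text{for each } i\in P.$$ Definition (partial matching of subspaces). $A$ is partially matched to $B$ with defect $d$ if for every ordered basis $\mathcal{A}$ of $A$ there exists an ordered basis $\mathcal{B}$ of $B$ such that $\mathcal{A}$ is partially matched to $\mathcal{B}$ with defect $d$. -}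

module Defs where

open import Level using (_⊔_; suc)
open import Algebra.Bundles using (CommutativeRing)
open import Algebra.Apartness.Bundles using (HeytingField; HeytingCommutativeRing)
open import Algebra.Module.Bundles using (LeftModule)
open import Algebra.Morphism.Structures using (module RingMorphisms)
import Algebra.Definitions.RawMonoid as RawMonoidDefinitions
import Algebra.Properties.AbelianGroup as AbelianGroupProperties
open import Data.Fin.Base using (Fin)
open import Data.Fin.Subset using (Subset; ∣_∣) renaming (_∈_ to _∈ᶠ_)
open import Data.Nat.Base using (ℕ; _∸_)
open import Data.Product.Base using (Σ; ∃; ∃₂; ∃-syntax; _×_; _,_; proj₁; proj₂)
open import Data.Vec.Functional using (Vector)
open import Relation.Binary.PropositionalEquality.Core using (_≢_; _≡_)
import Relation.Binary.Reasoning.Setoid as SetoidReasoning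
open import Relation.Nullary.Negation using (¬_)
open import Relation.Unary using (Pred; _∈_; _⊆_) renaming (_∩_ to _∩ᵖ_)

-- The library's Heyting fields serve as the fields: assuming excluded middle,
-- tightness forces the apartness x # y to be x ≉ y, so that a Heyting field is
-- exactly a (commutative) field with 0 ≉ 1.

fieldRing : ∀ {c ℓ₁ ℓ₂} → HeytingField c ℓ₁ ℓ₂ → CommutativeRing c ℓ₁
fieldRing F = HeytingCommutativeRing.commutativeRing
  (HeytingField.heytingCommutativeRing F)

module LinearAlgebra {k ℓk ℓ#} (K : HeytingField k ℓk ℓ#) where

  private
    module K = CommutativeRing (fieldRing K)

  VectorSpace : ∀ m ℓm → Set (k ⊔ ℓk ⊔ suc (m ⊔ ℓm))
  VectorSpace = LeftModule K.ring

  module _ {m ℓm} (V : VectorSpace m ℓm) where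
    open LeftModule V

    ∑ : ∀ {n} → Vector Carrierᴹ n → Carrierᴹ
    ∑ = RawMonoidDefinitions.sum +ᴹ-rawMonoid

    combination : ∀ {n} → Vector K.Carrier n → Vector Carrierᴹ n → Carrierᴹ
    combination c v = ∑ (λ i → c i *ₗ v i)

    Span : ∀ {p} → Pred Carrierᴹ p → Pred Carrierᴹ (k ⊔ m ⊔ ℓm ⊔ p)
    Span X x = ∃[ r ] Σ (Vector K.Carrier r) λ c → Σ (Vector Carrierᴹ r) λ v →
      (∀ i → v i ∈ X) × x ≈ᴹ combination c v

    Range : ∀ {n} → Vector Carrierᴹ n → Pred Carrierᴹ ℓm
    Range v x = ∃[ i ] x ≈ᴹ v i

    LinearlyIndependent : ∀ {n} → Vector Carrierᴹ n → Set (k ⊔ ℓk ⊔ ℓm)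
    LinearlyIndependent v =
      ∀ c → combination c v ≈ᴹ 0ᴹ → ∀ i → c i K.≈ K.0#

    IsOrderedBasis : ∀ {n} → Vector Carrierᴹ n → Set (k ⊔ ℓk ⊔ m ⊔ ℓm)
    IsOrderedBasis v = LinearlyIndependent v × (∀ x → x ∈ Span (Range v))

    -- Dimension as a relation: "dim V = n".
    HasDim : ℕ → Set (k ⊔ ℓk ⊔ m ⊔ ℓm)
    HasDim n = Σ (Vector Carrierᴹ n) IsOrderedBasis

    record Subspace p : Set (k ⊔ m ⊔ ℓm ⊔ suc p) where
      field
        Member    : Pred Carrierᴹ p
        respects  : ∀ {x y} → x ≈ᴹ y → x ∈ Member → y ∈ Member
        0-closed  : 0ᴹ ∈ Member
        +-closed  : ∀ {x y} → x ∈ Member → y ∈ Member → x +ᴹ y ∈ Member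
        *ₗ-closed : ∀ c {x} → x ∈ Member → c *ₗ x ∈ Member

  open Subspace public using (Member)

  module _ {m ℓm} {V : VectorSpace m ℓm} where
    open LeftModule V

    -1*ₗ≈- : ∀ x → (K.- K.1#) *ₗ x ≈ᴹ -ᴹ x
    -1*ₗ≈- x = AbelianGroupProperties.inverseˡ-unique +ᴹ-abelianGroup _ _ (begin
      (K.- K.1#) *ₗ x +ᴹ x              ≈⟨ +ᴹ-congˡ (≈ᴹ-sym (*ₗ-identityˡ x)) ⟩
      (K.- K.1#) *ₗ x +ᴹ K.1# *ₗ x      ≈⟨ ≈ᴹ-sym (*ₗ-distribʳ x _ _) ⟩
      (K.- K.1# K.+ K.1#) *ₗ x          ≈⟨ *ₗ-congʳ (K.-‿inverseˡ K.1#) ⟩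
      K.0# *ₗ x                         ≈⟨ *ₗ-zeroˡ x ⟩
      0ᴹ                                ∎)
      where open SetoidReasoning ≈ᴹ-setoid

    -‿closed : ∀ {p} (U : Subspace V p) {x} → x ∈ Member U → -ᴹ x ∈ Member U
    -‿closed U {x} x∈U = respects (-1*ₗ≈- x) (*ₗ-closed (K.- K.1#) x∈U)
      where open Subspace U

    toSpace : ∀ {p} → Subspace V p → VectorSpace (m ⊔ p) ℓm
    toSpace U = record
      { Carrierᴹ = ∃ U.Member
      ; _≈ᴹ_ = λ x y → proj₁ x ≈ᴹ proj₁ y
      ; _+ᴹ_ = λ x y → proj₁ x +ᴹ proj₁ y , U.+-closed (proj₂ x) (proj₂ y)
      ; _*ₗ_ = λ c x → c *ₗ proj₁ x , U.*ₗ-closed c (proj₂ x)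
      ; 0ᴹ = 0ᴹ , U.0-closed
      ; -ᴹ_ = λ x → -ᴹ proj₁ x , -‿closed U (proj₂ x)
      ; isLeftModule = record
        { isLeftSemimodule = record
          { +ᴹ-isCommutativeMonoid = record
            { isMonoid = record
              { isSemigroup = record
                { isMagma = record
                  { isEquivalence = record
                    { refl = ≈ᴹ-refl ; sym = ≈ᴹ-sym ; trans = ≈ᴹ-trans }
                  ; ∙-cong = +ᴹ-cong
                  }
                ; assoc = λ x y z → +ᴹ-assoc (proj₁ x) (proj₁ y) (proj₁ z)
                }
              ; identity = (λ x → +ᴹ-identityˡ (proj₁ x))
                         , (λ x → +ᴹ-identityʳ (proj₁ x))
              }
            ; comm = λ x y → +ᴹ-comm (proj₁ x) (proj₁ y)
            }
          ; isPreleftSemimodule = record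
            { *ₗ-cong = *ₗ-cong
            ; *ₗ-zeroˡ = λ x → *ₗ-zeroˡ (proj₁ x)
            ; *ₗ-distribʳ = λ x → *ₗ-distribʳ (proj₁ x)
            ; *ₗ-identityˡ = λ x → *ₗ-identityˡ (proj₁ x)
            ; *ₗ-assoc = λ c d x → *ₗ-assoc c d (proj₁ x)
            ; *ₗ-zeroʳ = *ₗ-zeroʳ
            ; *ₗ-distribˡ = λ c x y → *ₗ-distribˡ c (proj₁ x) (proj₁ y)
            }
          }
        ; -ᴹ‿cong = -ᴹ‿cong
        ; -ᴹ‿inverse = (λ x → -ᴹ‿inverseˡ (proj₁ x))
                     , (λ x → -ᴹ‿inverseʳ (proj₁ x))
        }
      }
      where
      module U = Subspace U

    infixr 7 _∩_
    _∩_ : ∀ {p q} → Subspace V p → Subspace V q → Subspace V (p ⊔ q)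
    U ∩ W = record
      { Member    = U.Member ∩ᵖ W.Member
      ; respects  = λ x≈y (u , w) → U.respects x≈y u , W.respects x≈y w
      ; 0-closed  = U.0-closed , W.0-closed
      ; +-closed  = λ (u , w) (u′ , w′) → U.+-closed u u′ , W.+-closed w w′
      ; *ₗ-closed = λ c (u , w) → U.*ₗ-closed c u , W.*ₗ-closed c w
      }
      where
      module U = Subspace U
      module W = Subspace W

    -- A subspace W of V, seen inside another subspace U (as W ∩ U if W ⊈ U).
    within : ∀ {p q} (U : Subspace V p) → Subspace V q → Subspace (toSpace U) q
    within U W = record
      { Member    = λ x → proj₁ x ∈ W.Member
      ; respects  = W.respects
      ; 0-closed  = W.0-closed
      ; +-closed  = W.+-closed
      ; *ₗ-closed = λ c → W.*ₗ-closed c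
      }
      where module W = Subspace W

    NonzeroSubspace : ∀ {p} → Subspace V p → Set (m ⊔ ℓm ⊔ p)
    NonzeroSubspace U = ∃[ x ] x ∈ Member U × ¬ (x ≈ᴹ 0ᴹ)

  -- The quotient has the same carrier, with x and y identified when
  -- x - y ∈ N.
  module _ {m ℓm} (V : VectorSpace m ℓm) where
    open LeftModule V
    open AbelianGroupProperties +ᴹ-abelianGroup using (⁻¹-∙-comm; ⁻¹-involutive)
    open SetoidReasoning ≈ᴹ-setoid

    private
      swap : ∀ a b c d → (a +ᴹ b) +ᴹ (c +ᴹ d) ≈ᴹ (a +ᴹ c) +ᴹ (b +ᴹ d)
      swap a b c d = begin
        (a +ᴹ b) +ᴹ (c +ᴹ d)  ≈⟨ +ᴹ-assoc a b _ ⟩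
        a +ᴹ (b +ᴹ (c +ᴹ d))  ≈⟨ +ᴹ-congˡ (≈ᴹ-sym (+ᴹ-assoc b c d)) ⟩
        a +ᴹ ((b +ᴹ c) +ᴹ d)  ≈⟨ +ᴹ-congˡ (+ᴹ-congʳ (+ᴹ-comm b c)) ⟩
        a +ᴹ ((c +ᴹ b) +ᴹ d)  ≈⟨ +ᴹ-congˡ (+ᴹ-assoc c b d) ⟩
        a +ᴹ (c +ᴹ (b +ᴹ d))  ≈⟨ ≈ᴹ-sym (+ᴹ-assoc a c _) ⟩
        (a +ᴹ c) +ᴹ (b +ᴹ d)  ∎

      cancel-middle : ∀ x y z → (x +ᴹ -ᴹ y) +ᴹ (y +ᴹ -ᴹ z) ≈ᴹ x +ᴹ -ᴹ z
      cancel-middle x y z = begin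
        (x +ᴹ -ᴹ y) +ᴹ (y +ᴹ -ᴹ z)  ≈⟨ +ᴹ-assoc x _ _ ⟩
        x +ᴹ (-ᴹ y +ᴹ (y +ᴹ -ᴹ z))  ≈⟨ +ᴹ-congˡ (≈ᴹ-sym (+ᴹ-assoc _ y _)) ⟩
        x +ᴹ ((-ᴹ y +ᴹ y) +ᴹ -ᴹ z)  ≈⟨ +ᴹ-congˡ (+ᴹ-congʳ (-ᴹ‿inverseˡ y)) ⟩
        x +ᴹ (0ᴹ +ᴹ -ᴹ z)           ≈⟨ +ᴹ-congˡ (+ᴹ-identityˡ _) ⟩
        x +ᴹ -ᴹ z                   ∎

      flip-difference : ∀ x y → -ᴹ (x +ᴹ -ᴹ y) ≈ᴹ y +ᴹ -ᴹ x
      flip-difference x y = begin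
        -ᴹ (x +ᴹ -ᴹ y)       ≈⟨ ≈ᴹ-sym (⁻¹-∙-comm x (-ᴹ y)) ⟩
        -ᴹ x +ᴹ -ᴹ (-ᴹ y)    ≈⟨ +ᴹ-congˡ (⁻¹-involutive y) ⟩
        -ᴹ x +ᴹ y            ≈⟨ +ᴹ-comm _ y ⟩
        y +ᴹ -ᴹ x            ∎

      sum-difference : ∀ x y u v →
        (x +ᴹ -ᴹ y) +ᴹ (u +ᴹ -ᴹ v) ≈ᴹ (x +ᴹ u) +ᴹ -ᴹ (y +ᴹ v)
      sum-difference x y u v =
        ≈ᴹ-trans (swap x (-ᴹ y) u (-ᴹ v)) (+ᴹ-congˡ (⁻¹-∙-comm y v))

      *ₗ-neg : ∀ c x → c *ₗ (-ᴹ x) ≈ᴹ -ᴹ (c *ₗ x)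
      *ₗ-neg c x = AbelianGroupProperties.inverseˡ-unique +ᴹ-abelianGroup _ _ (begin
        c *ₗ (-ᴹ x) +ᴹ c *ₗ x  ≈⟨ ≈ᴹ-sym (*ₗ-distribˡ c _ x) ⟩
        c *ₗ (-ᴹ x +ᴹ x)       ≈⟨ *ₗ-congˡ (-ᴹ‿inverseˡ x) ⟩
        c *ₗ 0ᴹ                ≈⟨ *ₗ-zeroʳ c ⟩
        0ᴹ                     ∎)

      scale-difference : ∀ c x y → c *ₗ (x +ᴹ -ᴹ y) ≈ᴹ c *ₗ x +ᴹ -ᴹ (c *ₗ y)
      scale-difference c x y =
        ≈ᴹ-trans (*ₗ-distribˡ c x _) (+ᴹ-congˡ (*ₗ-neg c y))

    infixl 6 _/_
    _/_ : ∀ {p} → Subspace V p → VectorSpace m p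
    _/_ {p} N = record
      { Carrierᴹ = Carrierᴹ
      ; _≈ᴹ_ = _∼_
      ; _+ᴹ_ = _+ᴹ_
      ; _*ₗ_ = _*ₗ_
      ; 0ᴹ = 0ᴹ
      ; -ᴹ_ = -ᴹ_
      ; isLeftModule = record
        { isLeftSemimodule = record
          { +ᴹ-isCommutativeMonoid = record
            { isMonoid = record
              { isSemigroup = record
                { isMagma = record
                  { isEquivalence = record
                    { refl  = ≈⇒∼ ≈ᴹ-refl
                    ; sym   = ∼-sym
                    ; trans = ∼-trans
                    }
                  ; ∙-cong = λ {x} {y} {u} {v} x∼y u∼v →
                      N.respects (sum-difference x y u v) (N.+-closed x∼y u∼v)
                  }
                ; assoc = λ x y z → ≈⇒∼ (+ᴹ-assoc x y z)
                }
              ; identity = (λ x → ≈⇒∼ (+ᴹ-identityˡ x))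
                         , (λ x → ≈⇒∼ (+ᴹ-identityʳ x))
              }
            ; comm = λ x y → ≈⇒∼ (+ᴹ-comm x y)
            }
          ; isPreleftSemimodule = record
            { *ₗ-cong = λ {c} {d} {x} {y} c≈d x∼y →
                ∼-trans (≈⇒∼ (*ₗ-cong c≈d ≈ᴹ-refl))
                        (N.respects (scale-difference d x y) (N.*ₗ-closed d x∼y))
            ; *ₗ-zeroˡ = λ x → ≈⇒∼ (*ₗ-zeroˡ x)
            ; *ₗ-distribʳ = λ x c d → ≈⇒∼ (*ₗ-distribʳ x c d)
            ; *ₗ-identityˡ = λ x → ≈⇒∼ (*ₗ-identityˡ x)
            ; *ₗ-assoc = λ c d x → ≈⇒∼ (*ₗ-assoc c d x)
            ; *ₗ-zeroʳ = λ c → ≈⇒∼ (*ₗ-zeroʳ c)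
            ; *ₗ-distribˡ = λ c x y → ≈⇒∼ (*ₗ-distribˡ c x y)
            }
          }
        ; -ᴹ‿cong = λ {x} {y} x∼y →
            N.respects (≈ᴹ-sym (⁻¹-∙-comm x (-ᴹ y))) (-‿closed N x∼y)
        ; -ᴹ‿inverse = (λ x → ≈⇒∼ (-ᴹ‿inverseˡ x))
                     , (λ x → ≈⇒∼ (-ᴹ‿inverseʳ x))
        }
      }
      where
      module N = Subspace N

      _∼_ : Carrierᴹ → Carrierᴹ → Set p
      x ∼ y = x +ᴹ -ᴹ y ∈ N.Member

      ≈⇒∼ : ∀ {x y} → x ≈ᴹ y → x ∼ y
      ≈⇒∼ {x} {y} x≈y = N.respects
        (≈ᴹ-sym (≈ᴹ-trans (+ᴹ-congʳ x≈y) (-ᴹ‿inverseʳ y))) N.0-closed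

      ∼-sym : ∀ {x y} → x ∼ y → y ∼ x
      ∼-sym {x} {y} x∼y = N.respects (flip-difference x y) (-‿closed N x∼y)

      ∼-trans : ∀ {x y z} → x ∼ y → y ∼ z → x ∼ z
      ∼-trans {x} {y} {z} x∼y y∼z =
        N.respects (cancel-middle x y z) (N.+-closed x∼y y∼z)

record FieldExtension c ℓ₁ ℓ₂ : Set (suc (c ⊔ ℓ₁ ⊔ ℓ₂)) where
  field
    K L : HeytingField c ℓ₁ ℓ₂

  module K = CommutativeRing (fieldRing K)
  module L = CommutativeRing (fieldRing L)

  open RingMorphisms K.rawRing L.rawRing using (IsRingMonomorphism)

  field
    ι                  : K.Carrier → L.Carrier
    isRingMonomorphism : IsRingMonomorphism ι

  open RingMorphisms.IsRingMonomorphism isRingMonomorphism public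
    using (+-homo; *-homo; 0#-homo; 1#-homo; -‿homo; injective; ⟦⟧-cong)

  IsProper : Set (c ⊔ ℓ₁)
  IsProper = ∃[ x ] ∀ k → ¬ (x L.≈ ι k)

  open LinearAlgebra K

  L-space : VectorSpace c ℓ₁
  L-space = record
    { Carrierᴹ = L.Carrier
    ; _≈ᴹ_ = L._≈_
    ; _+ᴹ_ = L._+_
    ; _*ₗ_ = λ k x → ι k L.* x
    ; 0ᴹ = L.0#
    ; -ᴹ_ = L.-_
    ; isLeftModule = record
      { isLeftSemimodule = record
        { +ᴹ-isCommutativeMonoid = L.+-isCommutativeMonoid
        ; isPreleftSemimodule = record
          { *ₗ-cong = λ c≈d x≈y → L.*-cong (⟦⟧-cong c≈d) x≈y
          ; *ₗ-zeroˡ = λ x → L.trans (L.*-congʳ 0#-homo) (L.zeroˡ x)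
          ; *ₗ-distribʳ = λ x c d →
              L.trans (L.*-congʳ (+-homo c d)) (L.distribʳ x (ι c) (ι d))
          ; *ₗ-identityˡ = λ x → L.trans (L.*-congʳ 1#-homo) (L.*-identityˡ x)
          ; *ₗ-assoc = λ c d x →
              L.trans (L.*-congʳ (*-homo c d)) (L.*-assoc (ι c) (ι d) x)
          ; *ₗ-zeroʳ = λ c → L.zeroʳ (ι c)
          ; *ₗ-distribˡ = λ c → L.distribˡ (ι c)
          }
        }
      ; -ᴹ‿cong = L.-‿cong
      ; -ᴹ‿inverse = L.-‿inverse
      }
    }

  -- K-subspaces of L, in the universe level in which spans live.
  LSubspace : Set (suc (c ⊔ ℓ₁))
  LSubspace = Subspace L-space (c ⊔ ℓ₁)

  DimIs : LSubspace → ℕ → Set (c ⊔ ℓ₁)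
  DimIs U n = HasDim (toSpace U) n

  QuotientDimIs : (U W : LSubspace) → ℕ → Set (c ⊔ ℓ₁)
  QuotientDimIs U W n = HasDim (toSpace U / within U W) n

  infixl 7 _·_
  _·_ : LSubspace → LSubspace → Pred L.Carrier (c ⊔ ℓ₁)
  (S · R) x = ∃₂ λ s r → s ∈ Member S × r ∈ Member R × x L.≈ s L.* r

  -- The sum U + K; it is direct exactly when 1 ∉ U.
  _⊕K : LSubspace → Pred L.Carrier (c ⊔ ℓ₁)
  (U ⊕K) x = ∃₂ λ u k → u ∈ Member U × x L.≈ u L.+ ι k

  -- a⁻¹ U = { a⁻¹ u : u ∈ U }, for a ≉ 0; here y is the inverse of a.
  _⁻¹·_ : L.Carrier → LSubspace → Pred L.Carrier (c ⊔ ℓ₁)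
  (a ⁻¹· U) x = ∃₂ λ y u → a L.* y L.≈ L.1# × u ∈ Member U × x L.≈ y L.* u

  OrderedBasis : LSubspace → ℕ → Set (c ⊔ ℓ₁)
  OrderedBasis U n = HasDim (toSpace U) n

  element : ∀ (U : LSubspace) {n} → OrderedBasis U n → Fin n → L.Carrier
  element U 𝒰 i = proj₁ (proj₁ 𝒰 i)

  Others : ∀ {n} → Vector L.Carrier n → Fin n → Pred L.Carrier ℓ₁
  Others b i x = ∃[ j ] j ≢ i × x L.≈ b j

  BasisPartiallyMatched : ∀ {n} (A B : LSubspace) →
    OrderedBasis A n → OrderedBasis B n → ℕ → Set (c ⊔ ℓ₁)
  BasisPartiallyMatched {n} A B 𝒜 ℬ d =
    Σ (Subset n) λ P → ∣ P ∣ ≡ n ∸ d ×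
      (∀ i → i ∈ᶠ P →
        (a i ⁻¹· A) ∩ᵖ Member B ⊆ Span L-space (Others b i))
    where
    a = element A 𝒜
    b = element B ℬ

  PartiallyMatched : ℕ → (A B : LSubspace) → ℕ → Set (c ⊔ ℓ₁)
  PartiallyMatched n A B d =
    (𝒜 : OrderedBasis A n) →
    Σ (OrderedBasis B n) λ ℬ → BasisPartiallyMatched A B 𝒜 ℬ d

{-# OPTIONS --safe #-}

-- For a basis a₁,…,aₙ of A put Uᵢ = aᵢ⁻¹A ∩ B.  By Rado's theorem, dualised,
-- a basis of B matching all but d of the aᵢ exists iff every intersection of
-- |J| of the Uᵢ has codimension at least |J| - d in B.  If this fails for J,
-- let S be the span of the aᵢ with i ∈ J and V = {x ∈ B ⊕ K : Sx ⊆ A}.  Dyson's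
-- e-transform replaces (S, V) by (S + eV, V ∩ e⁻¹S) for some e ∈ S, as long as
-- this enlarges S; it stops at a pair with SV = S, of the same total dimension,
-- which violates the dimension criterion because 1 ∈ V gives
-- dim (B ∩ V) = dim V - 1.  Conversely, extend a basis of S to one of A: the
-- basis of B matched to it has at least dim S - d members that are matched to
-- elements of S, and these are independent modulo B ∩ R, since SR = S ⊆ A puts
-- B ∩ R inside aᵢ⁻¹A ∩ B for aᵢ ∈ S.
module Submission where

open import Defs
open import Level using (_⊔_; Lift; lift; lower; Level)
open import Algebra.Apartness.Bundles using (HeytingField)
open import Algebra.Bundles using (CommutativeMonoid; CommutativeRing)
open import Algebra.Module.Bundles using (LeftModule)
import Algebra.Properties.CommutativeSemigroup as CommutativeSemigroupProperties
import Algebra.Properties.Ring as RingProperties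
open import Axiom.ExcludedMiddle using (ExcludedMiddle)
open import Data.Empty using (⊥; ⊥-elim)
open import Data.Fin.Base using (Fin; zero; suc; punchIn; punchOut)
import Data.Fin.Properties as Fin
open import Data.Fin.Subset as Subset using (Subset; inside; outside; ∣_∣; _∪_) renaming (_∈_ to _∈ᶠ_; _∩_ to _∩ᶠ_)
import Data.Fin.Subset.Properties as Subset
open import Data.Nat.Base using (ℕ; zero; suc; _+_; _∸_; _⊓_; _<_; _≤_; z≤n; s≤s)
import Data.Nat.Properties as ℕ
open import Data.Nat.Tactic.RingSolver using (solve-∀)
open import Data.Product.Base using (Σ; ∃; ∃-syntax; ∃₂; _×_; _,_; proj₁; proj₂; map₂)
open import Data.Sum.Base using (_⊎_; inj₁; inj₂; [_,_]′)
open import Data.Unit.Polymorphic.Base using (⊤; tt)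
open import Data.Vec.Base using (Vec; []; _∷_; _++_; lookup; tabulate; here; there)
import Data.Vec.Functional as Vector
import Data.Vec.Base as Vec
import Data.Vec.Properties as Vec
open import Data.Vec.Relation.Unary.All as All using (All; []; _∷_)
import Data.Vec.Relation.Unary.All.Properties as All
open import Function.Base using (_∘_)
open import Function.Bundles using (_⇔_; mk⇔)
open import Relation.Binary.PropositionalEquality as ≡ using (_≡_; _≢_)
import Relation.Binary.Reasoning.Setoid as SetoidReasoning
open import Relation.Nullary using (Dec; yes; no; ¬_; contradiction)
import Relation.Nullary.Decidable as Dec
open import Relation.Unary using (_∈_; _∉_; _⊆_; _≐_)

-- Excluded middle and cardinalities of finite subsets

-- Excluded middle is assumed at one universe level; lifting carries it to propositions of lower
-- levels.
decide : ∀ {a b} → ExcludedMiddle (a ⊔ b) → (P : Set a) → Dec P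
decide {b = b} em P = Dec.map′ lower lift (em {Lift b P})

∣∪∣+∣∩∣ : ∀ {n} (p q : Subset n) → ∣ p ∪ q ∣ + ∣ p ∩ᶠ q ∣ ≡ ∣ p ∣ + ∣ q ∣
∣∪∣+∣∩∣ []            []            = ≡.refl
∣∪∣+∣∩∣ (outside ∷ p) (outside ∷ q) = ∣∪∣+∣∩∣ p q
∣∪∣+∣∩∣ (inside ∷ p)  (outside ∷ q) = ≡.cong suc (∣∪∣+∣∩∣ p q)
∣∪∣+∣∩∣ (outside ∷ p) (inside ∷ q)  =
  ≡.trans (≡.cong suc (∣∪∣+∣∩∣ p q)) (≡.sym (ℕ.+-suc ∣ p ∣ ∣ q ∣))
∣∪∣+∣∩∣ (inside ∷ p)  (inside ∷ q)  = ≡.cong suc (begin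
  ∣ p ∪ q ∣ + suc ∣ p ∩ᶠ q ∣    ≡⟨ ℕ.+-suc ∣ p ∪ q ∣ ∣ p ∩ᶠ q ∣ ⟩
  suc (∣ p ∪ q ∣ + ∣ p ∩ᶠ q ∣)  ≡⟨ ≡.cong suc (∣∪∣+∣∩∣ p q) ⟩
  suc (∣ p ∣ + ∣ q ∣)           ≡⟨ ℕ.+-suc ∣ p ∣ ∣ q ∣ ⟨
  ∣ p ∣ + suc ∣ q ∣             ∎)
  where open ≡.≡-Reasoning

-- Fields with excluded middle

module Field {a ℓ ℓ#} (F : HeytingField a ℓ ℓ#) where
  open CommutativeRing (fieldRing F) public
  private module F = HeytingField F
  open RingProperties ring using (-0#≈0#)

  x-0≈x : ∀ x → x - 0# ≈ x
  x-0≈x x = trans (+-congˡ -0#≈0#) (+-identityʳ x)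

  -- Were `1# ≈ 0#`, all elements would be equal and `0# - 0#` invertible, which would put `0#`
  -- apart from itself.
  1≉0 : ¬ (1# ≈ 0#)
  1≉0 1≈0 = F.#-irrefl refl (F.invertible⇒# {0#} {0#} (0# , all≈ _ _ , all≈ _ _))
    where
    ≈0 : ∀ x → x ≈ 0#
    ≈0 x = trans (sym (*-identityˡ x)) (trans (*-congʳ 1≈0) (zeroˡ x))
    all≈ : ∀ x y → x ≈ y
    all≈ x y = trans (≈0 x) (sym (≈0 y))

  -- An element without an inverse cannot be apart from `0#`, so tightness makes it equal to `0#`.
  inverse : ExcludedMiddle (a ⊔ ℓ) → ∀ {x} → ¬ (x ≈ 0#) → ∃[ y ] y * x ≈ 1#
  inverse em {x} x≉0 with em {∃[ y ] y * x ≈ 1#}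
  ... | yes inv = inv
  ... | no ¬inv = contradiction (proj₁ (F.tight x 0#) x¬#0) x≉0
    where
    x¬#0 : ¬ (x F.# 0#)
    x¬#0 x#0 with F.#⇒invertible x#0
    ... | y , yx≈1 , _ = ¬inv (y , trans (*-congˡ (sym (x-0≈x x))) yx≈1)

-- Spans, relative independence and exchange

module Subspaces {k ℓk ℓ# m ℓm} (K : HeytingField k ℓk ℓ#)
  (V : LinearAlgebra.VectorSpace K m ℓm)
  (em : ExcludedMiddle (k ⊔ ℓk ⊔ m ⊔ ℓm)) where

  open LinearAlgebra K
  private module K = Field K
  open LeftModule V
  open CommutativeSemigroupProperties (CommutativeMonoid.commutativeSemigroup +ᴹ-commutativeMonoid)
    using (interchange)

  ℓ : Level
  ℓ = k ⊔ ℓk ⊔ m ⊔ ℓm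

  Sub : Set (Level.suc ℓ)
  Sub = Subspace V ℓ

  0ˢ : Sub
  0ˢ = record
    { Member    = λ x → Lift ℓ (x ≈ᴹ 0ᴹ)
    ; respects  = λ x≈y (lift x≈0) → lift (≈ᴹ-trans (≈ᴹ-sym x≈y) x≈0)
    ; 0-closed  = lift ≈ᴹ-refl
    ; +-closed  = λ (lift x≈0) (lift y≈0) →
        lift (≈ᴹ-trans (+ᴹ-cong x≈0 y≈0) (+ᴹ-identityˡ 0ᴹ))
    ; *ₗ-closed = λ c (lift x≈0) → lift (≈ᴹ-trans (*ₗ-congˡ x≈0) (*ₗ-zeroʳ c))
    }

  whole : Sub
  whole = record
    { Member    = λ _ → ⊤
    ; respects  = λ _ _ → tt
    ; 0-closed  = tt
    ; +-closed  = λ _ _ → tt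
    ; *ₗ-closed = λ _ _ → tt
    }

  0ˢ⊆ : (X : Sub) → Member 0ˢ ⊆ Member X
  0ˢ⊆ X (lift x≈0) = Subspace.respects X (≈ᴹ-sym x≈0) (Subspace.0-closed X)

  difference : ∀ {x y z} → z ≈ᴹ x +ᴹ y → x ≈ᴹ z +ᴹ -ᴹ y
  difference {x} {y} {z} z≈x+y = begin
    x                   ≈⟨ +ᴹ-identityʳ x ⟨
    x +ᴹ 0ᴹ             ≈⟨ +ᴹ-congˡ (-ᴹ‿inverseʳ y) ⟨
    x +ᴹ (y +ᴹ -ᴹ y)    ≈⟨ +ᴹ-assoc x y _ ⟨
    (x +ᴹ y) +ᴹ -ᴹ y    ≈⟨ +ᴹ-congʳ z≈x+y ⟨
    z +ᴹ -ᴹ y           ∎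
    where open SetoidReasoning ≈ᴹ-setoid

  module _ {p} (X : Subspace V p) where
    open Subspace X

    left-summand : ∀ {x y z} → z ≈ᴹ x +ᴹ y → z ∈ Member X → y ∈ Member X → x ∈ Member X
    left-summand z≈x+y z∈X y∈X =
      respects (≈ᴹ-sym (difference z≈x+y)) (+-closed z∈X (-‿closed X y∈X))

    right-summand : ∀ {x y z} → z ≈ᴹ x +ᴹ y → z ∈ Member X → x ∈ Member X → y ∈ Member X
    right-summand z≈x+y = left-summand (≈ᴹ-trans z≈x+y (+ᴹ-comm _ _))

    unscale : ∀ {α x} → ¬ (α K.≈ K.0#) → α *ₗ x ∈ Member X → x ∈ Member X
    unscale {α} {x} α≉0 αx∈X with K.inverse (λ {P} → decide {b = ℓ} em P) α≉0
    ... | β , βα≈1 = respects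
      (≈ᴹ-trans (≈ᴹ-sym (*ₗ-assoc β α x)) (≈ᴹ-trans (*ₗ-congʳ βα≈1) (*ₗ-identityˡ x)))
      (*ₗ-closed β αx∈X)

  adjoin : Sub → Carrierᴹ → Sub
  adjoin X x = record
    { Member    = λ z → ∃₂ λ u α → u ∈ X.Member × z ≈ᴹ u +ᴹ α *ₗ x
    ; respects  = λ z≈w (u , α , u∈X , z≈) → u , α , u∈X , ≈ᴹ-trans (≈ᴹ-sym z≈w) z≈
    ; 0-closed  = 0ᴹ , K.0# , X.0-closed ,
        ≈ᴹ-sym (≈ᴹ-trans (+ᴹ-identityˡ _) (*ₗ-zeroˡ x))
    ; +-closed  = λ (u , α , u∈X , z≈) (v , β , v∈X , w≈) →
        u +ᴹ v , α K.+ β , X.+-closed u∈X v∈X ,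
        ≈ᴹ-trans (+ᴹ-cong z≈ w≈)
          (≈ᴹ-trans (interchange u _ v _) (+ᴹ-congˡ (≈ᴹ-sym (*ₗ-distribʳ x α β))))
    ; *ₗ-closed = λ c (u , α , u∈X , z≈) →
        c *ₗ u , c K.* α , X.*ₗ-closed c u∈X ,
        ≈ᴹ-trans (*ₗ-congˡ z≈)
          (≈ᴹ-trans (*ₗ-distribˡ c u _) (+ᴹ-congˡ (≈ᴹ-sym (*ₗ-assoc c α x))))
    }
    where module X = Subspace X

  ⊆adjoin : ∀ X {x} → Member X ⊆ Member (adjoin X x)
  ⊆adjoin X {x} {u} u∈X = u , K.0# , u∈X ,
    ≈ᴹ-sym (≈ᴹ-trans (+ᴹ-congˡ (*ₗ-zeroˡ x)) (+ᴹ-identityʳ u))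

  ∈adjoin : ∀ X {x} → x ∈ Member (adjoin X x)
  ∈adjoin X {x} = 0ᴹ , K.1# , Subspace.0-closed X ,
    ≈ᴹ-sym (≈ᴹ-trans (+ᴹ-identityˡ _) (*ₗ-identityˡ x))

  adjoin-least : ∀ X (Z : Sub) {x} → Member X ⊆ Member Z → x ∈ Member Z →
    Member (adjoin X x) ⊆ Member Z
  adjoin-least X Z X⊆Z x∈Z (u , α , u∈X , z≈) =
    Z.respects (≈ᴹ-sym z≈) (Z.+-closed (X⊆Z u∈X) (Z.*ₗ-closed α x∈Z))
    where module Z = Subspace Z

  adjoin-swap : ∀ X {x z} → z ∈ Member (adjoin X x) → z ∉ Member X →
    x ∈ Member (adjoin X z)
  adjoin-swap X {x} {z} (u , α , u∈X , z≈) z∉X with decide {b = ℓ} em (α K.≈ K.0#)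
  ... | yes α≈0 = contradiction
    (Subspace.respects X
      (≈ᴹ-sym (≈ᴹ-trans z≈ (≈ᴹ-trans (+ᴹ-congˡ (≈ᴹ-trans (*ₗ-congʳ α≈0) (*ₗ-zeroˡ x))) (+ᴹ-identityʳ u))))
      u∈X)
    z∉X
  ... | no α≉0 = unscale (adjoin X z) α≉0
    (right-summand (adjoin X z) z≈ (∈adjoin X) (⊆adjoin X u∈X))

  span : ∀ {n} → Sub → Vec Carrierᴹ n → Sub
  span X []      = X
  span X (x ∷ v) = adjoin (span X v) x

  ⊆span : ∀ X {n} (v : Vec Carrierᴹ n) → Member X ⊆ Member (span X v)
  ⊆span X []      z∈X = z∈X
  ⊆span X (x ∷ v) z∈X = ⊆adjoin (span X v) (⊆span X v z∈X)

  ∈span : ∀ X {n} (v : Vec Carrierᴹ n) → All (_∈ Member (span X v)) v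
  ∈span X []      = []
  ∈span X (x ∷ v) = ∈adjoin (span X v) ∷ All.map (⊆adjoin (span X v)) (∈span X v)

  span-least : ∀ X Z {n} {v : Vec Carrierᴹ n} → Member X ⊆ Member Z →
    All (_∈ Member Z) v → Member (span X v) ⊆ Member Z
  span-least X Z             X⊆Z []          = X⊆Z
  span-least X Z {v = _ ∷ v} X⊆Z (x∈Z ∷ v⊆Z) =
    adjoin-least (span X v) Z (span-least X Z X⊆Z v⊆Z) x∈Z

  span-mono : ∀ X Y {n} (v : Vec Carrierᴹ n) → Member X ⊆ Member Y →
    Member (span X v) ⊆ Member (span Y v)
  span-mono X Y v X⊆Y = span-least X (span Y v) (⊆span Y v ∘ X⊆Y) (∈span Y v)

  -- Linear independence modulo `X`, phrased by adding one vector at a time so that it suits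
  -- induction; `IndependentMod` below is the version with coefficients.
  Free : ∀ {n} → Sub → Vec Carrierᴹ n → Set ℓ
  Free X []      = ⊤
  Free X (x ∷ v) = x ∉ Member (span X v) × Free X v

  Free-anti : ∀ X Y {n} (v : Vec Carrierᴹ n) → Member X ⊆ Member Y → Free Y v → Free X v
  Free-anti X Y []      X⊆Y _           = tt
  Free-anti X Y (x ∷ v) X⊆Y (x∉ , free) = x∉ ∘ span-mono X Y v X⊆Y , Free-anti X Y v X⊆Y free

  Free-++ : ∀ X Y {m n} (v : Vec Carrierᴹ m) (w : Vec Carrierᴹ n) →
    Member (span X w) ⊆ Member Y → Free Y v → Free X w → Free X (v ++ w)
  Free-++ X Y []      w _  _            freew = freew
  Free-++ X Y (x ∷ v) w ⊆Y (x∉ , freev) freew =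
    x∉ ∘ span-least X (span Y v) (⊆span Y v ∘ ⊆Y ∘ ⊆span X w)
           (All.++⁺ (∈span Y v) (All.map (⊆span Y v ∘ ⊆Y) (∈span X w)))
    , Free-++ X Y v w ⊆Y freev freew

  -- Replacing X by adjoin X x costs a family free over X at most one of its
  -- members, and costs one only if x lies in the span of the family.
  drop-one : ∀ X x {n} (u : Vec Carrierᴹ n) → Free X u →
    Free (adjoin X x) u ⊎
    (x ∈ Member (span X u) × ∃[ l ] n ≡ suc l × Σ (Vec Carrierᴹ l) λ w →
      All (_∈ Member (span X u)) w × Free (adjoin X x) w)
  drop-one X x []      _ = inj₁ tt
  drop-one X x (y ∷ u) (y∉ , free) with drop-one X x u free
  ... | inj₂ (x∈ , l , ≡.refl , w , w⊆ , freew) =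
    inj₂ (⊆adjoin U x∈ , suc l , ≡.refl , y ∷ w ,
          ∈adjoin U ∷ All.map (⊆adjoin U) w⊆ ,
          y∉ ∘ span-least (adjoin X x) U (adjoin-least X U (⊆span X u) x∈) w⊆ , freew)
    where U = span X u
  ... | inj₁ free′ with em {y ∈ Member (span (adjoin X x) u)}
  ...   | no y∉′ = inj₁ (y∉′ , free′)
  ...   | yes y∈ = inj₂ (adjoin-swap U y∈′ y∉ , _ , ≡.refl , u , All.map (⊆adjoin U) (∈span X u) , free′)
    where
    U = span X u
    y∈′ : y ∈ Member (adjoin U x)
    y∈′ = span-least (adjoin X x) (adjoin U x)
      (adjoin-least X (adjoin U x) (⊆adjoin U ∘ ⊆span X u) (∈adjoin U))
      (All.map (⊆adjoin U) (∈span X u)) y∈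

  span-adjoin : ∀ X x {n} (v : Vec Carrierᴹ n) →
    Member (span X (x ∷ v)) ⊆ Member (span (adjoin X x) v)
  span-adjoin X x v = adjoin-least (span X v) (span (adjoin X x) v)
    (span-mono X (adjoin X x) v (⊆adjoin X)) (⊆span (adjoin X x) v (∈adjoin X))

  -- Exchange by induction on `v`: its first vector moves into the base `X`, and by `drop-one` this
  -- costs `u` at most one member.
  steinitz : ∀ X {m n} {u : Vec Carrierᴹ m} (v : Vec Carrierᴹ n) → Free X u →
    All (_∈ Member (span X v)) u → m ≤ n
  steinitz X {u = []}    v  _        _        = z≤n
  steinitz X {u = y ∷ u} [] (y∉ , _) (y∈ ∷ _) = contradiction (⊆span X u y∈) y∉
  steinitz X {u = u@(_ ∷ _)} (x ∷ v) free u⊆ with drop-one X x u free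
  ... | inj₁ free′ =
    ℕ.m≤n⇒m≤1+n (steinitz (adjoin X x) v free′ (All.map (span-adjoin X x v) u⊆))
  ... | inj₂ (_ , l , ≡.refl , w , w⊆ , freew) =
    s≤s (steinitz (adjoin X x) v freew
      (All.map (span-adjoin X x v ∘ span-least X Y (⊆span X (x ∷ v)) u⊆) w⊆))
    where
    Y : Sub
    Y = span X (x ∷ v)

  -- Modular law: as `v` lies in `Y`, subtracting multiples of its members does not leave `Y`.
  ∩-span : ∀ (X Y : Sub) {n} {v : Vec Carrierᴹ n} → All (_∈ Member Y) v →
    Member (span X v ∩ Y) ⊆ Member (span (X ∩ Y) v)
  ∩-span X Y [] z∈ = z∈
  ∩-span X Y (x∈Y ∷ v⊆Y) ((u , α , u∈ , z≈) , z∈Y) =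
    u , α , ∩-span X Y v⊆Y (u∈ , left-summand Y z≈ z∈Y (Subspace.*ₗ-closed Y α x∈Y)) , z≈

  Free-∩ : ∀ (X Y : Sub) {n} {v : Vec Carrierᴹ n} → All (_∈ Member Y) v → Free (X ∩ Y) v → Free X v
  Free-∩ X Y []          _           = tt
  Free-∩ X Y (x∈Y ∷ v⊆Y) (x∉ , free) =
    (λ x∈ → x∉ (∩-span X Y v⊆Y (x∈ , x∈Y))) , Free-∩ X Y v⊆Y free

  -- Relative dimension

  -- dim Y / (X ∩ Y) = n.
  record RelDim (X Y : Sub) (n : ℕ) : Set ℓ where
    constructor relDim
    field
      {basis}  : Vec Carrierᴹ n
      within-Y : All (_∈ Member Y) basis
      free     : Free X basis
      spans    : Member Y ⊆ Member (span X basis)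

  RelDim-mono : ∀ {X X′ Y Y′ m n} → RelDim X Y m → RelDim X′ Y′ n →
    Member X′ ⊆ Member X → Member Y ⊆ Member Y′ → m ≤ n
  RelDim-mono {X} {X′} (relDim {u} u⊆Y free _) (relDim {v} _ _ spans) X′⊆X Y⊆Y′ =
    steinitz X v free (All.map (span-mono X′ X v X′⊆X ∘ spans ∘ Y⊆Y′) u⊆Y)

  RelDim-unique : ∀ {X Y m n} → RelDim X Y m → RelDim X Y n → m ≡ n
  RelDim-unique p q = ℕ.≤-antisym (RelDim-mono p q (λ x∈ → x∈) (λ x∈ → x∈)) (RelDim-mono q p (λ x∈ → x∈) (λ x∈ → x∈))

  RelDim-trans : ∀ {X Y Z m n} → Member X ⊆ Member Y → Member Y ⊆ Member Z →
    RelDim X Y m → RelDim Y Z n → RelDim X Z (n + m)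
  RelDim-trans {X} {Y} {Z} X⊆Y Y⊆Z (relDim {u} u⊆ freeu spanu) (relDim {v} v⊆ freev spanv) =
    relDim {basis = v ++ u} (All.++⁺ v⊆ (All.map Y⊆Z u⊆))
      (Free-++ X Y v u (span-least X Y X⊆Y u⊆) freev freeu)
      (λ z∈ → span-least Y (span X (v ++ u)) Y⊆span (All.++ˡ⁻ v (∈span X (v ++ u))) (spanv z∈))
    where
    Y⊆span : Member Y ⊆ Member (span X (v ++ u))
    Y⊆span = span-least X (span X (v ++ u)) (⊆span X (v ++ u))
      (All.++ʳ⁻ v (∈span X (v ++ u))) ∘ spanu

  -- A free family in `Y` is extended for as long as some vector of `Y` lies outside its span. By
  -- `steinitz`, a basis of `Y₀` over `X₀` bounds its length, so `N` units of fuel suffice.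
  RelDim-exists : ∀ X Y {X₀ Y₀ N} → RelDim X₀ Y₀ N →
    Member X₀ ⊆ Member X → Member Y ⊆ Member Y₀ → ∃ (RelDim X Y)
  RelDim-exists X Y {X₀} {Y₀} {N} (relDim {w} _ _ spans₀) X₀⊆X Y⊆Y₀ =
    extend N [] [] tt (ℕ.≤-reflexive (≡.sym (ℕ.+-identityʳ N)))
    where
    bound : ∀ {n} {v : Vec Carrierᴹ n} → All (_∈ Member Y) v → Free X v → n ≤ N
    bound v⊆ free = steinitz X w free (All.map (span-mono X₀ X w X₀⊆X ∘ spans₀ ∘ Y⊆Y₀) v⊆)

    extend : ∀ fuel {n} (v : Vec Carrierᴹ n) → All (_∈ Member Y) v → Free X v →
      N ≤ fuel + n → ∃ (RelDim X Y)
    extend fuel v v⊆ free N≤ with em {∃[ x ] x ∈ Member Y × x ∉ Member (span X v)}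
    ... | no none = _ , relDim v⊆ free spans
      where
      spans : Member Y ⊆ Member (span X v)
      spans {z} z∈ with em {z ∈ Member (span X v)}
      ... | yes z∈′ = z∈′
      ... | no z∉   = contradiction (z , z∈ , z∉) none
    extend zero v v⊆ free N≤ | yes (x , x∈ , x∉) =
      contradiction (ℕ.≤-trans (bound (x∈ ∷ v⊆) (x∉ , free)) N≤) (ℕ.<-irrefl ≡.refl)
    extend (suc fuel) {n} v v⊆ free N≤ | yes (x , x∈ , x∉) =
      extend fuel (x ∷ v) (x∈ ∷ v⊆) (x∉ , free) (ℕ.≤-trans N≤ (ℕ.≤-reflexive (≡.sym (ℕ.+-suc fuel n))))


  RelDim⇒nonzero : ∀ {X n} → RelDim 0ˢ X (suc n) → NonzeroSubspace X
  RelDim⇒nonzero (relDim {x ∷ v} (x∈ ∷ _) (x∉ , _) _) = x , x∈ , λ x≈0 → x∉ (⊆span 0ˢ v (lift x≈0))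

  -- Codimension in `B` and its submodularity

  -- The codimension of X ∩ B in B.
  module Codimension (B : Sub) {N} (dimB : RelDim 0ˢ B N) where

    codim-exists : ∀ (X : Sub) → ∃ (RelDim (X ∩ B) B)
    codim-exists X = RelDim-exists (X ∩ B) B dimB (0ˢ⊆ (X ∩ B)) (λ x∈ → x∈)

    codim : Sub → ℕ
    codim X = proj₁ (codim-exists X)

    codim-dim : ∀ X → RelDim (X ∩ B) B (codim X)
    codim-dim X = proj₂ (codim-exists X)

    codim-anti : ∀ X Y → Member (X ∩ B) ⊆ Member Y → codim Y ≤ codim X
    codim-anti X Y X∩B⊆Y =
      RelDim-mono (codim-dim Y) (codim-dim X) (λ z∈ → X∩B⊆Y z∈ , proj₂ z∈) (λ z∈ → z∈)

    Free⇒≤codim : ∀ X {n} {v : Vec Carrierᴹ n} → All (_∈ Member B) v → Free (X ∩ B) v → n ≤ codim X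
    Free⇒≤codim X {v = v} v⊆B free with codim-dim X
    ... | relDim {w} _ _ spans = steinitz (X ∩ B) w free (All.map spans v⊆B)

    codim-whole : codim whole ≡ 0
    codim-whole = ℕ.n≤0⇒n≡0
      (RelDim-mono (codim-dim whole) (relDim {whole ∩ B} {B} [] tt (tt ,_)) (λ z∈ → z∈) (λ z∈ → z∈))

    codim-0ˢ : N ≤ codim 0ˢ
    codim-0ˢ = RelDim-mono dimB (codim-dim 0ˢ) proj₁ (λ z∈ → z∈)

    -- `Z` is any subspace containing the sum of `X ∩ B` and `Y ∩ B`. A basis `y` of `Y ∩ B` over
    -- `(X ∩ Y) ∩ B` stays free over `X ∩ B` and lies in `Z`; joined to a basis of `B` over `Z ∩ B`,
    -- it bounds `codim X` from below.
    codim-modular : ∀ X Y Z → Member (X ∩ B) ⊆ Member Z → Member (Y ∩ B) ⊆ Member Z →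
      codim (X ∩ Y) + codim Z ≤ codim X + codim Y
    codim-modular X Y Z X∩B⊆Z Y∩B⊆Z
      with RelDim-exists ((X ∩ Y) ∩ B) (Y ∩ B) dimB (0ˢ⊆ ((X ∩ Y) ∩ B)) proj₂
    ... | l , Y/X@(relDim {y} y⊆ free _) = begin
      codim (X ∩ Y) + codim Z    ≡⟨ ≡.cong (_+ codim Z) (RelDim-unique (codim-dim (X ∩ Y))
                                      (RelDim-trans (λ ((_ , z∈Y) , z∈B) → z∈Y , z∈B) proj₂ Y/X (codim-dim Y))) ⟩
      (codim Y + l) + codim Z    ≡⟨ ℕ.+-assoc (codim Y) l _ ⟩
      codim Y + (l + codim Z)    ≤⟨ ℕ.+-monoʳ-≤ (codim Y) l+Z≤X ⟩
      codim Y + codim X          ≡⟨ ℕ.+-comm (codim Y) (codim X) ⟩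
      codim X + codim Y          ∎
      where
      open ℕ.≤-Reasoning
      W : Sub
      W = span (X ∩ B) y
      W⊆Z : Member W ⊆ Member (Z ∩ B)
      W⊆Z = span-least (X ∩ B) (Z ∩ B) (λ z∈ → X∩B⊆Z z∈ , proj₂ z∈)
              (All.map (λ z∈ → Y∩B⊆Z z∈ , proj₂ z∈) y⊆)
      free′ : Free (X ∩ B) y
      free′ = Free-∩ (X ∩ B) (Y ∩ B) y⊆
        (Free-anti ((X ∩ B) ∩ (Y ∩ B)) ((X ∩ Y) ∩ B) y
          (λ ((z∈X , z∈B) , (z∈Y , _)) → (z∈X , z∈Y) , z∈B) free)
      l+Z≤X : l + codim Z ≤ codim X
      l+Z≤X with codim-dim Z
      ... | relDim {v} v⊆ freev _ = ≡.subst (_≤ codim X) (ℕ.+-comm (codim Z) l)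
        (Free⇒≤codim X (All.++⁺ v⊆ (All.map proj₂ y⊆))
          (Free-++ (X ∩ B) (Z ∩ B) v y W⊆Z freev free′))

    codim-∩ : ∀ X Y → codim (X ∩ Y) ≤ codim X + codim Y
    codim-∩ X Y = ℕ.≤-trans (ℕ.m≤m+n (codim (X ∩ Y)) (codim whole)) (codim-modular X Y whole _ _)

    codim-adjoin : ∀ X {x} → x ∈ Member B → x ∉ Member X → codim (adjoin X x) < codim X
    codim-adjoin X {x} x∈B x∉X with codim-dim (adjoin X x)
    ... | relDim {v} v⊆ free _ = ≡.subst (_≤ codim X) (ℕ.+-comm (codim (adjoin X x)) 1)
      (Free⇒≤codim X (All.++⁺ v⊆ (x∈B ∷ []))
        (Free-++ (X ∩ B) (adjoin X x ∩ B) v (x ∷ [])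
          (adjoin-least (X ∩ B) (adjoin X x ∩ B) (λ z∈ → ⊆adjoin X (proj₁ z∈) , proj₂ z∈) (∈adjoin X , x∈B))
          free (x∉X ∘ proj₁ , tt)))

    ∃∉ : ∀ X Y → codim X < codim Y → ∃[ x ] x ∈ Member (X ∩ B) × x ∉ Member Y
    ∃∉ X Y X<Y with em {∃[ x ] x ∈ Member (X ∩ B) × x ∉ Member Y}
    ... | yes p = p
    ... | no ¬p = contradiction (codim-anti X Y X∩B⊆Y) (ℕ.<⇒≱ X<Y)
      where
      X∩B⊆Y : Member (X ∩ B) ⊆ Member Y
      X∩B⊆Y {x} x∈ with em {x ∈ Member Y}
      ... | yes x∈Y = x∈Y
      ... | no x∉Y  = contradiction (x , x∈ , x∉Y) ¬p

    -- Hall's condition and growth to a hyperplane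

    ⋂ : ∀ {m} → Subset m → (Fin m → Sub) → Sub
    ⋂ J U = record
      { Member    = λ x → ∀ i → i ∈ᶠ J → x ∈ Member (U i)
      ; respects  = λ x≈y x∈ i i∈J → Subspace.respects (U i) x≈y (x∈ i i∈J)
      ; 0-closed  = λ i _ → Subspace.0-closed (U i)
      ; +-closed  = λ x∈ y∈ i i∈J → Subspace.+-closed (U i) (x∈ i i∈J) (y∈ i i∈J)
      ; *ₗ-closed = λ c x∈ i i∈J → Subspace.*ₗ-closed (U i) c (x∈ i i∈J)
      }

    ⋂-inside : ∀ {m} (J : Subset m) U →
      Member (U zero ∩ ⋂ J (U ∘ suc)) ⊆ Member (⋂ (inside ∷ J) U)
    ⋂-inside J U (x∈ , _)  zero    here        = x∈
    ⋂-inside J U (_  , x∈) (suc i) (there i∈J) = x∈ i i∈J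

    ⋂-tail : ∀ {m} b (J : Subset m) U → Member (⋂ (b ∷ J) U) ⊆ Member (⋂ J (U ∘ suc))
    ⋂-tail b J U x∈ i i∈J = x∈ (suc i) (there i∈J)

    ⋂-outside : ∀ {m} (J : Subset m) U → Member (⋂ J (U ∘ suc)) ⊆ Member (⋂ (outside ∷ J) U)
    ⋂-outside J U x∈ (suc i) (there i∈J) = x∈ i i∈J

    -- Rado's condition with defect `d`, relative to `X`: cutting `X` by the `U i` with `i` in `J`
    -- raises the codimension by at least `∣ J ∣ - d`.
    Hall : ∀ {m} → Sub → (Fin m → Sub) → ℕ → Set
    Hall X U d = ∀ J → ∣ J ∣ + codim X ≤ d + codim (X ∩ ⋂ J U)

    -- Hall for the family Y, U restricted to the index sets containing that of Y.
    HallAt : ∀ {m} → Sub → Sub → (Fin m → Sub) → ℕ → Set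
    HallAt X Y U d = ∀ J → suc ∣ J ∣ + codim X ≤ d + codim ((X ∩ Y) ∩ ⋂ J U)

    hallAt? : ∀ {m} X Y (U : Fin m → Sub) d → HallAt X Y U d ⊎
      ∃[ J ] d + codim ((X ∩ Y) ∩ ⋂ J U) ≤ ∣ J ∣ + codim X
    hallAt? X Y U d
      with decide {b = ℓ} em (∃[ J ] d + codim ((X ∩ Y) ∩ ⋂ J U) ≤ ∣ J ∣ + codim X)
    ... | yes bad = inj₂ bad
    ... | no ¬bad = inj₁ λ J → ℕ.≰⇒> λ le → ¬bad (J , le)

    -- For `grow`: the two enlargements `adjoin Y x` and `adjoin Y y` obtained this way meet only in
    -- `Y`.
    two-outside : ∀ {X Y n} → RelDim (Y ∩ X) X (suc (suc n)) →
      ∃₂ λ x y → (x ∈ Member X × x ∉ Member Y) × (y ∈ Member X × y ∉ Member (adjoin Y x))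
    two-outside {X} {Y} (relDim {y ∷ x ∷ v} (y∈ ∷ x∈ ∷ _) (y∉ , x∉ , _) _) =
      x , y ,
      (x∈ , λ x∈Y → x∉ (⊆span (Y ∩ X) v (x∈Y , x∈))) ,
      (y∈ , λ y∈′ → y∉ (span-mono (Y ∩ X) (span (Y ∩ X) v) (x ∷ []) (⊆span (Y ∩ X) v)
                          (∩-span Y X {v = x ∷ []} (x∈ ∷ []) (y∈′ , y∈))))

    -- In order, the hypotheses are the condition at a union and at an intersection, submodularity,
    -- two violations, and the count of union and intersection. Their sum is contradictory because
    -- of the `suc` in the first.
    submodular-contradiction : ∀ d x {p q a b u i j j′} →
      suc u + x ≤ d + p → i + x ≤ d + q → p + q ≤ a + b →
      d + a ≤ j + x → d + b ≤ j′ + x → u + i ≡ j + j′ → ⊥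
    submodular-contradiction d x {p} {q} {a} {b} {u} {i} {j} {j′} h₁ h₂ h₃ h₄ h₅ eq =
      ℕ.<-irrefl ≡.refl (begin-strict
        (u + i) + (x + x)        <⟨ ℕ.≤-reflexive (≡.sym (regroup (suc u) x i x)) ⟩
        (suc u + x) + (i + x)    ≤⟨ ℕ.+-mono-≤ h₁ h₂ ⟩
        (d + p) + (d + q)        ≡⟨ regroup d p d q ⟩
        (d + d) + (p + q)        ≤⟨ ℕ.+-monoʳ-≤ (d + d) h₃ ⟩
        (d + d) + (a + b)        ≡⟨ regroup d a d b ⟨
        (d + a) + (d + b)        ≤⟨ ℕ.+-mono-≤ h₄ h₅ ⟩
        (j + x) + (j′ + x)       ≡⟨ regroup j x j′ x ⟩
        (j + j′) + (x + x)       ≡⟨ ≡.cong (_+ (x + x)) eq ⟨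
        (u + i) + (x + x)        ∎)
      where
      open ℕ.≤-Reasoning
      regroup : ∀ a b c d → (a + b) + (c + d) ≡ (a + c) + (b + d)
      regroup = solve-∀

    -- If both adjoin Y x and adjoin Y y violate the condition, at J₁ and J₂,
    -- then submodularity violates it for Y at J₁ ∪ J₂ or Hall at J₁ ∩ J₂.
    grow : ∀ {m} X (U : Fin m → Sub) d → Hall X U d →
      ∀ fuel Y → codim Y ≤ fuel → HallAt X Y U d →
      Σ Sub λ H → Member Y ⊆ Member H × HallAt X H U d × codim H ≤ 1
    grow X U d hall fuel Y Y≤fuel hallY with codim Y in eq | codim-dim Y
    ... | 0 | _ = Y , (λ z∈ → z∈) , hallY , ℕ.≤-trans (ℕ.≤-reflexive eq) z≤n
    ... | 1 | _ = Y , (λ z∈ → z∈) , hallY , ℕ.≤-reflexive eq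
    grow X U d hall (suc fuel) Y (s≤s Y≤fuel) hallY | suc (suc n) | dimY
      with two-outside {B} {Y} dimY
    ... | x , y , (x∈B , x∉Y) , (y∈B , y∉) with hallAt? X (adjoin Y x) U d | hallAt? X (adjoin Y y) U d
    ... | inj₁ hall₁ | _ =
      map₂ (λ (⊆H , rest) → ⊆H ∘ ⊆adjoin Y , rest)
        (grow X U d hall fuel (adjoin Y x)
          (ℕ.≤-trans (ℕ.≤-pred (≡.subst (codim (adjoin Y x) <_) eq (codim-adjoin Y x∈B x∉Y))) Y≤fuel) hall₁)
    ... | _ | inj₁ hall₂ =
      map₂ (λ (⊆H , rest) → ⊆H ∘ ⊆adjoin Y , rest)
        (grow X U d hall fuel (adjoin Y y)
          (ℕ.≤-trans (ℕ.≤-pred (≡.subst (codim (adjoin Y y) <_) eq (codim-adjoin Y y∈B (y∉ ∘ ⊆adjoin Y)))) Y≤fuel) hall₂)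
    ... | inj₂ (J₁ , bad₁) | inj₂ (J₂ , bad₂) = ⊥-elim
      (submodular-contradiction d (codim X)
        (ℕ.≤-trans (hallY (J₁ ∪ J₂)) (ℕ.+-monoʳ-≤ d (codim-anti (Z₁ ∩ Z₂) ((X ∩ Y) ∩ ⋂ (J₁ ∪ J₂) U) meet)))
        (hall (J₁ ∩ᶠ J₂))
        (codim-modular Z₁ Z₂ (X ∩ ⋂ (J₁ ∩ᶠ J₂) U) join₁ join₂)
        bad₁ bad₂ (∣∪∣+∣∩∣ J₁ J₂))
      where
      Z₁ Z₂ : Sub
      Z₁ = (X ∩ adjoin Y x) ∩ ⋂ J₁ U
      Z₂ = (X ∩ adjoin Y y) ∩ ⋂ J₂ U
      -- A common vector `z` outside `Y` could be exchanged for `y`, which would then lie in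
      -- `adjoin Y x`.
      Y₁∩Y₂⊆Y : Member (adjoin Y x ∩ adjoin Y y) ⊆ Member Y
      Y₁∩Y₂⊆Y {z} (z∈₁ , z∈₂) with em {z ∈ Member Y}
      ... | yes z∈Y = z∈Y
      ... | no z∉Y  = contradiction
        (adjoin-least Y (adjoin Y x) (⊆adjoin Y) z∈₁ (adjoin-swap Y z∈₂ z∉Y)) y∉
      meet : Member ((Z₁ ∩ Z₂) ∩ B) ⊆ Member ((X ∩ Y) ∩ ⋂ (J₁ ∪ J₂) U)
      meet ((((z∈X , z∈₁) , z∈⋂₁) , ((_ , z∈₂) , z∈⋂₂)) , _) =
        (z∈X , Y₁∩Y₂⊆Y (z∈₁ , z∈₂)) ,
        λ i i∈ → [ z∈⋂₁ i , z∈⋂₂ i ]′ (Subset.x∈p∪q⁻ J₁ J₂ i∈)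
      join₁ : Member (Z₁ ∩ B) ⊆ Member (X ∩ ⋂ (J₁ ∩ᶠ J₂) U)
      join₁ (((z∈X , _) , z∈⋂) , _) = z∈X , λ i i∈ → z∈⋂ i (proj₁ (Subset.x∈p∩q⁻ J₁ J₂ i∈))
      join₂ : Member (Z₂ ∩ B) ⊆ Member (X ∩ ⋂ (J₁ ∩ᶠ J₂) U)
      join₂ (((z∈X , _) , z∈⋂) , _) = z∈X , λ i i∈ → z∈⋂ i (proj₂ (Subset.x∈p∩q⁻ J₁ J₂ i∈))

    -- Supplies the hyperplane of an index that is given up: tied to no `U i`, it only has to cut
    -- `Z` further. It is grown from the zero subspace with an empty family; if `Z` already has full
    -- codimension, `whole` serves.
    separate : ∀ Z → Σ Sub λ H → codim H ≤ 1 × suc (codim Z) ⊓ N ≤ codim (Z ∩ H)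
    separate Z with ℕ.≤-<-connex N (codim Z)
    ... | inj₁ N≤Z = whole , ℕ.≤-trans (ℕ.≤-reflexive codim-whole) z≤n ,
      ℕ.≤-trans (ℕ.m⊓n≤n _ N) (ℕ.≤-trans N≤Z (codim-anti (Z ∩ whole) Z (λ ((z∈ , _) , _) → z∈)))
    ... | inj₂ Z<N with grow Z (λ ()) 0 hall (codim 0ˢ) 0ˢ ℕ.≤-refl hall₀
      where
      hall : Hall Z (λ ()) 0
      hall [] = codim-anti (Z ∩ ⋂ [] (λ ())) Z (λ ((z∈ , _) , _) → z∈)
      hall₀ : HallAt Z 0ˢ (λ ()) 0
      hall₀ [] = ℕ.≤-trans Z<N (ℕ.≤-trans codim-0ˢ
        (codim-anti ((Z ∩ 0ˢ) ∩ ⋂ [] (λ ())) 0ˢ (λ (((_ , z∈) , _) , _) → z∈)))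
    ...   | H , _ , hallH , H≤1 = H , H≤1 ,
      ℕ.≤-trans (ℕ.m⊓n≤m _ N) (ℕ.≤-trans (hallH [])
        (codim-anti (Z ∩ H) ((Z ∩ H) ∩ ⋂ [] (λ ())) (λ (z∈ , _) → z∈ , λ ())))

    -- Rado's theorem and dual vectors

    -- As each `H i` has codimension at most one, `independent` says that every one of the `m`
    -- subspaces cuts `X` and the others properly, including those with index outside `P`.
    record Hyperplanes {m} (X : Sub) (U : Fin m → Sub) (d : ℕ) : Set (Level.suc ℓ) where
      field
        P           : Subset m
        H           : Fin m → Sub
        ∣P∣         : ∣ P ∣ ≡ m ∸ d
        codim-H     : ∀ i → codim (H i) ≤ 1
        U⊆H         : ∀ i → i ∈ᶠ P → Member (U i) ⊆ Member (H i)
        independent : codim X + m ≤ codim (X ∩ ⋂ Subset.⊤ H)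

    -- Rado's theorem in dual form: a condition on intersections of the U i
    -- lets all but d of them be enlarged to independent hyperplanes.
    rado : ∀ m X (U : Fin m → Sub) d → Hall X U d → codim X + m ≤ N → Hyperplanes X U d
    rado zero X U d hall X≤N = record
      { P           = []
      ; H           = λ ()
      ; ∣P∣         = ≡.sym (ℕ.0∸n≡0 d)
      ; codim-H     = λ ()
      ; U⊆H         = λ ()
      ; independent = ℕ.≤-trans (ℕ.≤-reflexive (ℕ.+-identityʳ (codim X)))
                        (codim-anti (X ∩ ⋂ [] (λ ())) X (λ ((z∈ , _) , _) → z∈))
      }
    rado (suc m) X U d hall X+m<N
      with grow X (U ∘ suc) d hall-tail (codim (U zero)) (U zero) ℕ.≤-refl hallAt
      where
      hall-tail : Hall X (U ∘ suc) d
      hall-tail J = ℕ.≤-trans (hall (outside ∷ J)) (ℕ.+-monoʳ-≤ d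
        (codim-anti (X ∩ ⋂ J (U ∘ suc)) (X ∩ ⋂ (outside ∷ J) U)
          (λ ((z∈X , z∈) , _) → z∈X , ⋂-outside J U z∈)))
      hallAt : HallAt X (U zero) (U ∘ suc) d
      hallAt J = ℕ.≤-trans (hall (inside ∷ J)) (ℕ.+-monoʳ-≤ d
        (codim-anti ((X ∩ U zero) ∩ ⋂ J (U ∘ suc)) (X ∩ ⋂ (inside ∷ J) U)
          (λ (((z∈X , z∈U) , z∈) , _) → z∈X , ⋂-inside J U (z∈U , z∈))))
    ... | H₀ , U⊆H₀ , hallH₀ , H₀≤1 with ℕ.≤-<-connex (codim (X ∩ H₀)) (codim X)
    -- Here `H₀` cuts `X` properly, so it serves as the hyperplane of index `zero` and the recursion
    -- continues relative to `X ∩ H₀`. The `suc` in `hallH₀` pays for the increased codimension.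
    ...   | inj₂ X<X∩H₀ = keep (rado m (X ∩ H₀) (U ∘ suc) d hall′ (ℕ.≤-trans (ℕ.+-monoˡ-≤ m X∩H₀≤) X+m≤N))
      where
      X∩H₀≤ : codim (X ∩ H₀) ≤ suc (codim X)
      X∩H₀≤ = ℕ.≤-trans (codim-∩ X H₀)
        (ℕ.≤-trans (ℕ.+-monoʳ-≤ (codim X) H₀≤1) (ℕ.≤-reflexive (ℕ.+-comm (codim X) 1)))
      X+m≤N : suc (codim X) + m ≤ N
      X+m≤N = ≡.subst (_≤ N) (ℕ.+-suc (codim X) m) X+m<N
      hall′ : Hall (X ∩ H₀) (U ∘ suc) d
      hall′ J = ℕ.≤-trans
        (≡.subst (∣ J ∣ + codim (X ∩ H₀) ≤_) (ℕ.+-suc ∣ J ∣ (codim X)) (ℕ.+-monoʳ-≤ ∣ J ∣ X∩H₀≤))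
        (hallH₀ J)
      keep : Hyperplanes (X ∩ H₀) (U ∘ suc) d → Hyperplanes X U d
      keep r = record
        { P           = proj₁ P′
        ; H           = H₀ Vector.∷ H
        ; ∣P∣         = proj₁ (proj₂ P′)
        ; codim-H     = λ { zero → H₀≤1 ; (suc i) → codim-H i }
        ; U⊆H         = λ { zero _ → U⊆H₀ ; (suc i) i∈ → U⊆H i (proj₂ (proj₂ P′) i∈) }
        ; independent = begin
            codim X + suc m                              ≡⟨ ℕ.+-suc (codim X) m ⟩
            suc (codim X) + m                            ≤⟨ ℕ.+-monoˡ-≤ m X<X∩H₀ ⟩
            codim (X ∩ H₀) + m                           ≤⟨ independent ⟩
            codim ((X ∩ H₀) ∩ ⋂ Subset.⊤ H)              ≤⟨ codim-anti (X ∩ ⋂ Subset.⊤ (H₀ Vector.∷ H)) ((X ∩ H₀) ∩ ⋂ Subset.⊤ H) refine ⟩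
            codim (X ∩ ⋂ Subset.⊤ (H₀ Vector.∷ H))       ∎
        }
        where
        open Hyperplanes r
        open ℕ.≤-Reasoning
        refine : Member ((X ∩ ⋂ Subset.⊤ (H₀ Vector.∷ H)) ∩ B) ⊆ Member ((X ∩ H₀) ∩ ⋂ Subset.⊤ H)
        refine ((z∈X , z∈) , _) = (z∈X , z∈ zero here) , ⋂-tail inside Subset.⊤ (H₀ Vector.∷ H) z∈
        -- When `m < d`, truncation makes both `m ∸ d` and `suc m ∸ d` zero, so index `zero` is left
        -- out of the matched set.
        P′ : ∃[ Q ] ∣ Q ∣ ≡ suc m ∸ d × (∀ {i} → suc i ∈ᶠ Q → i ∈ᶠ P)
        P′ with ℕ.≤-<-connex d m
        ... | inj₁ d≤m = inside ∷ P , ≡.trans (≡.cong suc ∣P∣) (≡.sym (ℕ.+-∸-assoc 1 d≤m)) , Subset.drop-there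
        ... | inj₂ m<d = outside ∷ P ,
          ≡.trans ∣P∣ (≡.trans (ℕ.m≤n⇒m∸n≡0 (ℕ.<⇒≤ m<d)) (≡.sym (ℕ.m≤n⇒m∸n≡0 m<d))) , Subset.drop-there
    -- With no defect available, the condition at the empty set says that `H₀` cuts `X`, so this
    -- case cannot occur.
    rado (suc m) X U zero hall X+m<N | H₀ , _ , hallH₀ , _ | inj₁ X∩H₀≤X =
      ⊥-elim (ℕ.<-irrefl ≡.refl (begin-strict
        codim X                                          <⟨ s≤s (ℕ.m≤n+m (codim X) ∣ Subset.⊥ {m} ∣) ⟩
        suc ∣ Subset.⊥ {m} ∣ + codim X                   ≤⟨ hallH₀ Subset.⊥ ⟩
        codim ((X ∩ H₀) ∩ ⋂ Subset.⊥ (U ∘ suc))          ≤⟨ codim-anti (X ∩ H₀) ((X ∩ H₀) ∩ ⋂ Subset.⊥ (U ∘ suc))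
                                                              (λ (z∈ , _) → z∈ , λ i i∈ → contradiction i∈ Subset.∉⊥) ⟩
        codim (X ∩ H₀)                                   ≤⟨ X∩H₀≤X ⟩
        codim X                                          ∎))
      where open ℕ.≤-Reasoning
    -- Index `zero` is given up at the price of one unit of defect. Since `H₀` does not cut `X`,
    -- submodularity removes it from `hallH₀`, leaving the condition with defect `d` for the other
    -- indices.
    rado (suc m) X U (suc d) hall X+m<N | H₀ , _ , hallH₀ , _ | inj₁ X∩H₀≤X =
      drop (rado m X (U ∘ suc) d hall′ (ℕ.≤-trans (ℕ.+-monoʳ-≤ (codim X) (ℕ.n≤1+n m)) X+m<N))
      where
      open ℕ.≤-Reasoning
      hall′ : Hall X (U ∘ suc) d
      hall′ J = ℕ.≤-pred (begin
        suc ∣ J ∣ + codim X                              ≤⟨ hallH₀ J ⟩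
        suc d + codim ((X ∩ H₀) ∩ ⋂ J (U ∘ suc))         ≤⟨ ℕ.+-monoʳ-≤ (suc d)
                                                              (codim-anti ((X ∩ H₀) ∩ Y) ((X ∩ H₀) ∩ ⋂ J (U ∘ suc)) λ ((z∈ , (_ , z∈′)) , _) → z∈ , z∈′) ⟩
        suc d + codim ((X ∩ H₀) ∩ Y)                     ≤⟨ ℕ.+-monoʳ-≤ (suc d) (ℕ.+-cancelʳ-≤ (codim X) _ _ meet) ⟩
        suc d + codim Y                                  ∎)
        where
        Y : Sub
        Y = X ∩ ⋂ J (U ∘ suc)
        meet : codim ((X ∩ H₀) ∩ Y) + codim X ≤ codim Y + codim X
        meet = begin
          codim ((X ∩ H₀) ∩ Y) + codim X   ≤⟨ codim-modular (X ∩ H₀) Y X (proj₁ ∘ proj₁) (proj₁ ∘ proj₁) ⟩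
          codim (X ∩ H₀) + codim Y         ≤⟨ ℕ.+-monoˡ-≤ (codim Y) X∩H₀≤X ⟩
          codim X + codim Y                ≡⟨ ℕ.+-comm (codim X) (codim Y) ⟩
          codim Y + codim X                ∎
      drop : Hyperplanes X (U ∘ suc) d → Hyperplanes X U (suc d)
      drop r with separate (X ∩ ⋂ Subset.⊤ (Hyperplanes.H r))
      ... | H₁ , H₁≤1 , sep = record
        { P           = outside ∷ P
        ; H           = H₁ Vector.∷ H
        ; ∣P∣         = ∣P∣
        ; codim-H     = λ { zero → H₁≤1 ; (suc i) → codim-H i }
        ; U⊆H         = λ { (suc i) i∈ → U⊆H i (Subset.drop-there i∈) }
        ; independent = begin
            -- The hypothesis `X+m<N` says that there is room in `B` for one more independent
            -- hyperplane.
            codim X + suc m                              ≤⟨ ℕ.⊓-glb X+m<Z X+m<N ⟩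
            suc (codim Z) ⊓ N                            ≤⟨ sep ⟩
            codim (Z ∩ H₁)                               ≤⟨ codim-anti (X ∩ ⋂ Subset.⊤ (H₁ Vector.∷ H)) (Z ∩ H₁) refine ⟩
            codim (X ∩ ⋂ Subset.⊤ (H₁ Vector.∷ H))       ∎
        }
        where
        open Hyperplanes r
        Z : Sub
        Z = X ∩ ⋂ Subset.⊤ H
        refine : Member ((X ∩ ⋂ Subset.⊤ (H₁ Vector.∷ H)) ∩ B) ⊆ Member (Z ∩ H₁)
        refine ((z∈X , z∈) , _) = (z∈X , ⋂-tail inside Subset.⊤ (H₁ Vector.∷ H) z∈) , z∈ zero here
        X+m<Z : codim X + suc m ≤ suc (codim Z)
        X+m<Z = ≡.subst (_≤ suc (codim Z)) (≡.sym (ℕ.+-suc (codim X) m)) (s≤s independent)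

    codim-⋂ : ∀ {m} (J : Subset m) (H : Fin m → Sub) → (∀ i → codim (H i) ≤ 1) → codim (⋂ J H) ≤ ∣ J ∣
    codim-⋂ [] H _ = ℕ.≤-trans (codim-anti whole (⋂ [] H) (λ _ ())) (ℕ.≤-reflexive codim-whole)
    codim-⋂ (outside ∷ J) H H≤1 = ℕ.≤-trans
      (codim-anti (⋂ J (H ∘ suc)) (⋂ (outside ∷ J) H) (λ (z∈ , _) → ⋂-outside J H z∈))
      (codim-⋂ J (H ∘ suc) (H≤1 ∘ suc))
    codim-⋂ (inside ∷ J) H H≤1 = ℕ.≤-trans
      (codim-anti (H zero ∩ ⋂ J (H ∘ suc)) (⋂ (inside ∷ J) H) (λ (z∈ , _) → ⋂-inside J H z∈))
      (ℕ.≤-trans (codim-∩ (H zero) (⋂ J (H ∘ suc)))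
        (ℕ.+-mono-≤ (H≤1 zero) (codim-⋂ J (H ∘ suc) (H≤1 ∘ suc))))

    -- The hyperplanes other than `H i` meet in codimension at most `N ∸ 1`, so their intersection
    -- has a vector in `B` that some hyperplane excludes, and that can only be `H i`. These vectors
    -- will form the basis of `B` dual to the hyperplanes.
    dual-vector : (H : Fin N → Sub) → (∀ i → codim (H i) ≤ 1) → N ≤ codim (⋂ Subset.⊤ H) →
      ∀ i → ∃[ x ] x ∈ Member B × (∀ j → j ≢ i → x ∈ Member (H j)) × x ∉ Member (H i)
    dual-vector H H≤1 N≤ i with ∃∉ (⋂ (Subset.∁ Subset.⁅ i ⁆) H) (⋂ Subset.⊤ H) (begin-strict
        codim (⋂ (Subset.∁ Subset.⁅ i ⁆) H)  ≤⟨ codim-⋂ (Subset.∁ Subset.⁅ i ⁆) H H≤1 ⟩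
        ∣ Subset.∁ Subset.⁅ i ⁆ ∣            ≡⟨ Subset.∣∁p∣≡n∸∣p∣ Subset.⁅ i ⁆ ⟩
        N ∸ ∣ Subset.⁅ i ⁆ ∣                 ≡⟨ ≡.cong (N ∸_) (Subset.∣⁅x⁆∣≡1 i) ⟩
        N ∸ 1                                <⟨ N∸1<N i ⟩
        N                                    ≤⟨ N≤ ⟩
        codim (⋂ Subset.⊤ H)                 ∎)
      where
      open ℕ.≤-Reasoning
      -- The index `i` is the evidence that `N` is positive.
      N∸1<N : ∀ {n} → Fin n → n ∸ 1 < n
      N∸1<N {suc n} _ = ℕ.≤-refl
    ... | x , (x∈ , x∈B) , x∉ = x , x∈B , others , λ x∈Hi → x∉ λ j _ → all x∈Hi j
      where
      others : ∀ j → j ≢ i → x ∈ Member (H j)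
      others j j≢i = x∈ j (Subset.x∉p⇒x∈∁p (j≢i ∘ Subset.x∈⁅y⁆⇒x≡y i))
      all : x ∈ Member (H i) → ∀ j → x ∈ Member (H j)
      all x∈Hi j with j Fin.≟ i
      ... | yes ≡.refl = x∈Hi
      ... | no j≢i     = others j j≢i

  -- Bases, subfamilies and separation

  Basis⇒≤span : ∀ {n} {Y} (v : Vec Carrierᴹ n) → RelDim 0ˢ Y n → All (_∈ Member Y) v → Free 0ˢ v →
    Member Y ⊆ Member (span 0ˢ v)
  Basis⇒≤span v (relDim {w} _ _ spans) v⊆ free {z} z∈ with em {z ∈ Member (span 0ˢ v)}
  ... | yes z∈′ = z∈′
  ... | no z∉ = contradiction (steinitz 0ˢ w (z∉ , free) (All.map spans (z∈ ∷ v⊆))) ℕ.1+n≰n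

  others : ∀ {n} → Vector.Vector Carrierᴹ n → Fin n → Sub
  others {suc n} b i = span 0ˢ (tabulate (b ∘ punchIn i))

  ∈others : ∀ {n} (b : Vector.Vector Carrierᴹ n) {i j} → j ≢ i → b j ∈ Member (others b i)
  ∈others {suc n} b {i} {j} j≢i =
    ≡.subst (λ l → b l ∈ Member (others b i)) (Fin.punchIn-punchOut (j≢i ∘ ≡.sym))
      (All.tabulate⁻ (∈span 0ˢ (tabulate (b ∘ punchIn i))) (punchOut (j≢i ∘ ≡.sym)))

  others-least : ∀ {n} (b : Vector.Vector Carrierᴹ n) i (Z : Sub) →
    (∀ j → j ≢ i → b j ∈ Member Z) → Member (others b i) ⊆ Member Z
  others-least {suc n} b i Z b∈Z = span-least 0ˢ Z (0ˢ⊆ Z)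
    (All.tabulate⁺ λ j → b∈Z (punchIn i j) (Fin.punchInᵢ≢i i j))

  span⊆adjoin-others : ∀ {n} (b : Vector.Vector Carrierᴹ n) i →
    Member (span 0ˢ (tabulate b)) ⊆ Member (adjoin (others b i) (b i))
  span⊆adjoin-others b i = span-least 0ˢ Z (0ˢ⊆ Z) (All.tabulate⁺ member)
    where
    Z : Sub
    Z = adjoin (others b i) (b i)
    member : ∀ j → b j ∈ Member Z
    member j with j Fin.≟ i
    ... | yes ≡.refl = ∈adjoin (others b i)
    ... | no j≢i     = ⊆adjoin (others b i) (∈others b j≢i)

  -- Otherwise all `suc n` free vectors would lie in the span of `n` of them, against `steinitz`.
  ∉others : ∀ {n} (b : Vector.Vector Carrierᴹ n) → Free 0ˢ (tabulate b) → ∀ i → b i ∉ Member (others b i)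
  ∉others {suc n} b free i bᵢ∈ =
    ℕ.1+n≰n (steinitz 0ˢ (tabulate (b ∘ punchIn i)) free (All.tabulate⁺ member))
    where
    member : ∀ j → b j ∈ Member (others b i)
    member j with j Fin.≟ i
    ... | yes ≡.refl = bᵢ∈
    ... | no j≢i     = ∈others b j≢i

  -- `Z i` separates `b i` from `X` and from the rest of the family, so no relation modulo `X` can
  -- involve `b i`.
  Free-tabulate : ∀ {n} X (b : Vector.Vector Carrierᴹ n) (Z : Fin n → Sub) →
    (∀ i → Member X ⊆ Member (Z i)) → (∀ i j → j ≢ i → b j ∈ Member (Z i)) →
    (∀ i → b i ∉ Member (Z i)) → Free X (tabulate b)
  Free-tabulate {zero}  X b Z X⊆Z b∈Z b∉Z = tt
  Free-tabulate {suc n} X b Z X⊆Z b∈Z b∉Z =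
    b∉Z zero ∘ span-least X (Z zero) (X⊆Z zero) (All.tabulate⁺ λ j → b∈Z zero (suc j) λ ()) ,
    Free-tabulate X (b ∘ suc) (Z ∘ suc) (X⊆Z ∘ suc)
      (λ i j j≢i → b∈Z (suc i) (suc j) (j≢i ∘ Fin.suc-injective)) (b∉Z ∘ suc)

  select : ∀ {n} (J : Subset n) → Vector.Vector Carrierᴹ n → Vec Carrierᴹ ∣ J ∣
  select []            b = []
  select (inside ∷ J)  b = b zero ∷ select J (b ∘ suc)
  select (outside ∷ J) b = select J (b ∘ suc)

  select-All : ∀ {p} {P : Carrierᴹ → Set p} {n} (J : Subset n) {b} →
    (∀ i → i ∈ᶠ J → P (b i)) → All P (select J b)
  select-All []            Pb = []
  select-All (inside ∷ J)  Pb = Pb zero here ∷ select-All J (λ i i∈ → Pb (suc i) (there i∈))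
  select-All (outside ∷ J) Pb = select-All J (λ i i∈ → Pb (suc i) (there i∈))

  -- The argument of `Free-tabulate` for a subfamily. `X` has to lie in `Z i` only for `i` in `J`,
  -- as is the case for `B ∩ R` and the matched indices of a basis of `S`.
  Free-select : ∀ {n} X (J : Subset n) (b : Vector.Vector Carrierᴹ n) (Z : Fin n → Sub) →
    (∀ i → i ∈ᶠ J → Member X ⊆ Member (Z i)) → (∀ i j → j ≢ i → b j ∈ Member (Z i)) →
    (∀ i → b i ∉ Member (Z i)) → Free X (select J b)
  Free-select X []            b Z X⊆Z b∈Z b∉Z = tt
  Free-select X (outside ∷ J) b Z X⊆Z b∈Z b∉Z =
    Free-select X J (b ∘ suc) (Z ∘ suc) (λ i i∈ → X⊆Z (suc i) (there i∈))
      (λ i j j≢i → b∈Z (suc i) (suc j) (j≢i ∘ Fin.suc-injective)) (b∉Z ∘ suc)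
  Free-select X (inside ∷ J)  b Z X⊆Z b∈Z b∉Z =
    b∉Z zero ∘ span-least X (Z zero) (X⊆Z zero here)
      (select-All J (λ j _ → b∈Z zero (suc j) λ ())) ,
    Free-select X J (b ∘ suc) (Z ∘ suc) (λ i i∈ → X⊆Z (suc i) (there i∈))
      (λ i j j≢i → b∈Z (suc i) (suc j) (j≢i ∘ Fin.suc-injective)) (b∉Z ∘ suc)

  -- Translation to ordered bases, dimensions and quotients

  ∑-closed : ∀ {p} (X : Subspace V p) {n} {c} {b : Vector.Vector Carrierᴹ n} →
    (∀ i → b i ∈ Member X) → combination V c b ∈ Member X
  ∑-closed X {zero}  b∈ = Subspace.0-closed X
  ∑-closed X {suc n} {c} b∈ =
    Subspace.+-closed X (Subspace.*ₗ-closed X (c zero) (b∈ zero)) (∑-closed X (b∈ ∘ suc))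

  span⇒combination : ∀ X {n} (b : Vector.Vector Carrierᴹ n) {z} → z ∈ Member (span X (tabulate b)) →
    ∃₂ λ u c → u ∈ Member X × z ≈ᴹ u +ᴹ combination V c b
  span⇒combination X {zero}  b {z} z∈ = z , (λ ()) , z∈ , ≈ᴹ-sym (+ᴹ-identityʳ z)
  span⇒combination X {suc n} b {z} (w , α , w∈ , z≈) with span⇒combination X (b ∘ suc) w∈
  ... | u , c , u∈ , w≈ = u , α Vector.∷ c , u∈ , (begin
    z                                                      ≈⟨ z≈ ⟩
    w +ᴹ α *ₗ b zero                                       ≈⟨ +ᴹ-congʳ w≈ ⟩
    (u +ᴹ combination V c (b ∘ suc)) +ᴹ α *ₗ b zero        ≈⟨ +ᴹ-assoc u _ _ ⟩
    u +ᴹ (combination V c (b ∘ suc) +ᴹ α *ₗ b zero)        ≈⟨ +ᴹ-congˡ (+ᴹ-comm _ _) ⟩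
    u +ᴹ (α *ₗ b zero +ᴹ combination V c (b ∘ suc))        ∎)
    where open SetoidReasoning ≈ᴹ-setoid

  IndependentMod : ∀ {n} → Sub → Vector.Vector Carrierᴹ n → Set _
  IndependentMod X b = ∀ c → combination V c b ∈ Member X → ∀ i → c i K.≈ K.0#

  Free⇒IndependentMod : ∀ X {n} (b : Vector.Vector Carrierᴹ n) → Free X (tabulate b) → IndependentMod X b
  Free⇒IndependentMod X {suc n} b (b₀∉ , free) c c∈ = coefficients
    where
    W : Sub
    W = span X (tabulate (b ∘ suc))
    c₀≈0 : c zero K.≈ K.0#
    c₀≈0 with decide {b = ℓ} em (c zero K.≈ K.0#)
    ... | yes c₀≈0 = c₀≈0
    ... | no c₀≉0 = contradiction
      (unscale W c₀≉0 (left-summand W ≈ᴹ-refl (⊆span X (tabulate (b ∘ suc)) c∈)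
        (∑-closed W {c = c ∘ suc} (All.tabulate⁻ (∈span X (tabulate (b ∘ suc)))))))
      b₀∉
    coefficients : ∀ i → c i K.≈ K.0#
    coefficients zero    = c₀≈0
    coefficients (suc i) = Free⇒IndependentMod X (b ∘ suc) free (c ∘ suc)
      (right-summand X ≈ᴹ-refl c∈
        (Subspace.respects X (≈ᴹ-sym (≈ᴹ-trans (*ₗ-congʳ c₀≈0) (*ₗ-zeroˡ (b zero)))) (Subspace.0-closed X))) i

  IndependentMod⇒Free : ∀ X {n} (b : Vector.Vector Carrierᴹ n) → IndependentMod X b → Free X (tabulate b)
  IndependentMod⇒Free X {zero}  b ind = tt
  IndependentMod⇒Free X {suc n} b ind = b₀∉ ,
    IndependentMod⇒Free X (b ∘ suc) λ c c∈ i → ind (K.0# Vector.∷ c)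
      (Subspace.+-closed X (Subspace.respects X (≈ᴹ-sym (*ₗ-zeroˡ (b zero))) (Subspace.0-closed X)) c∈) (suc i)
    where
    b₀∉ : b zero ∉ Member (span X (tabulate (b ∘ suc)))
    b₀∉ b₀∈ with span⇒combination X (b ∘ suc) b₀∈
    -- Moving `b zero` to the other side gives it the coefficient `- 1`, and independence would make
    -- this zero.
    ... | u , c , u∈ , b₀≈ = K.1≉0 (K.trans (K.sym (-‿involutive K.1#))
        (K.trans (K.-‿cong (ind (K.- K.1# Vector.∷ c) comb∈ zero)) -0#≈0#))
      where
      open RingProperties K.ring using (-‿involutive; -0#≈0#)
      open SetoidReasoning ≈ᴹ-setoid
      r : Carrierᴹ
      r = combination V c (b ∘ suc)
      comb∈ : (K.- K.1#) *ₗ b zero +ᴹ r ∈ Member X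
      comb∈ = right-summand X (begin
        0ᴹ                                         ≈⟨ -ᴹ‿inverseʳ (b zero) ⟨
        b zero +ᴹ -ᴹ b zero                        ≈⟨ +ᴹ-cong b₀≈ (≈ᴹ-sym (-1*ₗ≈- {V = V} (b zero))) ⟩
        (u +ᴹ r) +ᴹ (K.- K.1#) *ₗ b zero           ≈⟨ +ᴹ-assoc u r _ ⟩
        u +ᴹ (r +ᴹ (K.- K.1#) *ₗ b zero)           ≈⟨ +ᴹ-congˡ (+ᴹ-comm r _) ⟩
        u +ᴹ ((K.- K.1#) *ₗ b zero +ᴹ r)           ∎) (Subspace.0-closed X) u∈

  module _ (Y : Sub) where

    private
      proj₁-combination : ∀ {n} c (v : Vector.Vector (∃ (Member Y)) n) →
        proj₁ (combination (toSpace Y) c v) ≈ᴹ combination V c (proj₁ ∘ v)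
      proj₁-combination {zero}  c v = ≈ᴹ-refl
      proj₁-combination {suc n} c v = +ᴹ-congˡ (proj₁-combination (c ∘ suc) (v ∘ suc))

    OrderedBasis⇒Free : ∀ {n} (v : Vector.Vector (∃ (Member Y)) n) → IsOrderedBasis (toSpace Y) v →
      Free 0ˢ (tabulate (proj₁ ∘ v))
    OrderedBasis⇒Free v (independent , _) = IndependentMod⇒Free 0ˢ (proj₁ ∘ v)
      λ c (lift c≈0) → independent c (≈ᴹ-trans (proj₁-combination c v) c≈0)

    HasDim⇒RelDim : ∀ {n} → HasDim (toSpace Y) n → RelDim 0ˢ Y n
    HasDim⇒RelDim (v , basis@(_ , spans)) = relDim (All.tabulate⁺ (proj₂ ∘ v)) (OrderedBasis⇒Free v basis)
      λ {z} z∈ → let (r , c , w , w∈ , z≈) = spans (z , z∈) in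
        Subspace.respects W (≈ᴹ-sym (≈ᴹ-trans z≈ (proj₁-combination c w)))
          (∑-closed W λ i → Subspace.respects W (≈ᴹ-sym (proj₂ (w∈ i)))
            (All.tabulate⁻ (∈span 0ˢ (tabulate (proj₁ ∘ v))) (proj₁ (w∈ i))))
      where
      W : Sub
      W = span 0ˢ (tabulate (proj₁ ∘ v))

    HasDim/⇒RelDim : ∀ X {n} → HasDim (toSpace Y / within Y X) n → RelDim X Y n
    HasDim/⇒RelDim X (v , independent , spans) = relDim (All.tabulate⁺ (proj₂ ∘ v))
      (IndependentMod⇒Free X b λ c c∈ → independent c (Subspace.respects X
        (≈ᴹ-trans (≈ᴹ-sym (proj₁-combination c v)) (difference (≈ᴹ-sym (+ᴹ-identityʳ _)))) c∈))
      λ {z} z∈ → let (r , c , w , w∈ , z∼) = spans (z , z∈) in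
        from-difference z∼ (Subspace.respects W (≈ᴹ-sym (proj₁-combination c w))
          (∑-closed W λ i → from-difference (proj₂ (w∈ i)) (All.tabulate⁻ (∈span X (tabulate b)) (proj₁ (w∈ i)))))
      where
      b = proj₁ ∘ v
      W : Sub
      W = span X (tabulate b)
      from-difference : ∀ {x y} → x +ᴹ -ᴹ y ∈ Member X → y ∈ Member W → x ∈ Member W
      from-difference x-y∈ y∈ = left-summand W ≈ᴹ-refl (⊆span X (tabulate b) x-y∈) (-‿closed W y∈)

    Free⇒OrderedBasis : ∀ {n} (v : Vector.Vector (∃ (Member Y)) n) → Free 0ˢ (tabulate (proj₁ ∘ v)) →
      Member Y ⊆ Member (span 0ˢ (tabulate (proj₁ ∘ v))) → IsOrderedBasis (toSpace Y) v
    Free⇒OrderedBasis v free Y⊆ =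
      (λ c c≈0 → Free⇒IndependentMod 0ˢ (proj₁ ∘ v) free c
        (lift (≈ᴹ-trans (≈ᴹ-sym (proj₁-combination c v)) c≈0))) ,
      λ (z , z∈) → let (u , c , lift u≈0 , z≈) = span⇒combination 0ˢ (proj₁ ∘ v) (Y⊆ z∈) in
        _ , c , v , (λ i → i , ≈ᴹ-refl) ,
        ≈ᴹ-trans z≈ (≈ᴹ-trans (+ᴹ-congʳ u≈0) (≈ᴹ-trans (+ᴹ-identityˡ _) (≈ᴹ-sym (proj₁-combination c v))))

    RelDim⇒vectors : ∀ {X n} → RelDim X Y n → Σ (Vector.Vector (∃ (Member Y)) n) λ v →
      Free X (tabulate (proj₁ ∘ v)) × Member Y ⊆ Member (span X (tabulate (proj₁ ∘ v)))
    RelDim⇒vectors {X} (relDim {b} b∈ free spans) =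
      (λ i → lookup b i , All.lookup⁺ b∈ i) ,
      ≡.subst (λ w → Free X w × Member Y ⊆ Member (span X w)) (≡.sym (Vec.tabulate∘lookup b)) (free , spans)

    RelDim⇒HasDim : ∀ {n} → RelDim 0ˢ Y n → HasDim (toSpace Y) n
    RelDim⇒HasDim dim = let (v , free , spans) = RelDim⇒vectors dim in v , Free⇒OrderedBasis v free spans

    RelDim⇒HasDim/ : ∀ X {n} → RelDim X Y n → HasDim (toSpace Y / within Y X) n
    RelDim⇒HasDim/ X dim = let (v , free , spans) = RelDim⇒vectors {X} dim in v ,
      (λ c c≈0 → Free⇒IndependentMod X (proj₁ ∘ v) free c (Subspace.respects X
        (≈ᴹ-trans (≈ᴹ-sym (difference (≈ᴹ-sym (+ᴹ-identityʳ _)))) (proj₁-combination c v)) c≈0)) ,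
      λ (z , z∈) → let (u , c , u∈ , z≈) = span⇒combination X (proj₁ ∘ v) (spans z∈) in
        _ , c , v , (λ i → i , Subspace.respects X (≈ᴹ-sym (-ᴹ‿inverseʳ _)) (Subspace.0-closed X)) ,
        Subspace.respects X (difference (≈ᴹ-trans z≈ (+ᴹ-congˡ (≈ᴹ-sym (proj₁-combination c v))))) u∈

  -- Subtracting from a vector of `H` its part in `others b i`, which lies in `H` too, leaves a
  -- multiple of `b i` in `H`; its coefficient must vanish.
  ∈others-by-separation : ∀ {n} (b : Vector.Vector Carrierᴹ n) i (H : Sub) →
    (∀ j → j ≢ i → b j ∈ Member H) → b i ∉ Member H →
    Member (span 0ˢ (tabulate b) ∩ H) ⊆ Member (others b i)
  ∈others-by-separation b i H b∈H bᵢ∉H {x} (x∈ , x∈H) with span⊆adjoin-others b i x∈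
  ... | w , α , w∈ , x≈ with decide {b = ℓ} em (α K.≈ K.0#)
  ...   | yes α≈0 = Subspace.respects (others b i)
    (≈ᴹ-sym (≈ᴹ-trans x≈ (≈ᴹ-trans (+ᴹ-congˡ (≈ᴹ-trans (*ₗ-congʳ α≈0) (*ₗ-zeroˡ (b i)))) (+ᴹ-identityʳ w)))) w∈
  ...   | no α≉0 = contradiction
    (unscale H α≉0 (right-summand H x≈ x∈H (others-least b i H b∈H w∈))) bᵢ∉H

  others⊆Span : ∀ {n} (b : Vector.Vector Carrierᴹ n) i {X : Carrierᴹ → Set ℓm} →
    (∀ j → j ≢ i → b j ∈ X) → Member (others b i) ⊆ Span V X
  others⊆Span {suc n} b i b∈X w∈ =
    let (u , c , lift u≈0 , w≈) = span⇒combination 0ˢ (b ∘ punchIn i) w∈ in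
    n , c , b ∘ punchIn i , (λ j → b∈X (punchIn i j) (Fin.punchInᵢ≢i i j)) ,
    ≈ᴹ-trans w≈ (≈ᴹ-trans (+ᴹ-congʳ u≈0) (+ᴹ-identityˡ _))

-- Multiplication in the extension field

module Matching {c ℓ₁ ℓ₂} (em : ExcludedMiddle (c ⊔ ℓ₁)) (E : FieldExtension c ℓ₁ ℓ₂) where
  open FieldExtension E
  open LinearAlgebra K
  open Subspaces K L-space em
  open CommutativeSemigroupProperties L.*-commutativeSemigroup using (x∙yz≈y∙xz; x∙yz≈z∙yx)
  open RingProperties L.ring using (-‿distribʳ-*)

  infixr 8 _⁻¹′_
  -- As a preimage under multiplication, `e⁻¹X` is formed without inverting `e`.
  _⁻¹′_ : L.Carrier → Sub → Sub
  e ⁻¹′ X = record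
    { Member    = λ x → e L.* x ∈ X.Member
    ; respects  = λ x≈y → X.respects (L.*-congˡ x≈y)
    ; 0-closed  = X.respects (L.sym (L.zeroʳ e)) X.0-closed
    ; +-closed  = λ x∈ y∈ → X.respects (L.sym (L.distribˡ e _ _)) (X.+-closed x∈ y∈)
    ; *ₗ-closed = λ k x∈ → X.respects (x∙yz≈y∙xz (ι k) e _) (X.*ₗ-closed k x∈)
    }
    where module X = Subspace X

  -- A relation modulo `S` between multiples by `e` pulls back to one modulo `V ∩ e ⁻¹′ S`; the
  -- subtracted terms stay in `V` because `y` does.
  span-⁻¹′ : ∀ e (S V : Sub) {m} {y : Vec L.Carrier m} → All (_∈ Member V) y → ∀ {z} → z ∈ Member V →
    e L.* z ∈ Member (span S (Vec.map (e L.*_) y)) → z ∈ Member (span (V ∩ e ⁻¹′ S) y)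
  span-⁻¹′ e S V []                 z∈V ez∈ = z∈V , ez∈
  span-⁻¹′ e S V {y = x ∷ y} (x∈V ∷ y⊆V) {z} z∈V (w , α , w∈ , ez≈) =
    z′ , α , span-⁻¹′ e S V y⊆V (V.+-closed z∈V (-‿closed V (V.*ₗ-closed α x∈V)))
      (Subspace.respects (span S (Vec.map (e L.*_) y)) w≈ez′ w∈) , z≈
    where
    module V = Subspace V
    open SetoidReasoning L.setoid
    z′ = z L.- ι α L.* x
    w≈ez′ : w L.≈ e L.* z′
    w≈ez′ = begin
      w                                     ≈⟨ difference ez≈ ⟩
      e L.* z L.- ι α L.* (e L.* x)         ≈⟨ L.+-congˡ (L.-‿cong (x∙yz≈y∙xz (ι α) e x)) ⟩
      e L.* z L.- e L.* (ι α L.* x)         ≈⟨ L.+-congˡ (-‿distribʳ-* e _) ⟩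
      e L.* z L.+ e L.* (L.- (ι α L.* x))   ≈⟨ L.distribˡ e z _ ⟨
      e L.* z′                              ∎
    z≈ : z L.≈ z′ L.+ ι α L.* x
    z≈ = L.sym (begin
      (z L.- ι α L.* x) L.+ ι α L.* x       ≈⟨ L.+-assoc z _ _ ⟩
      z L.+ (L.- (ι α L.* x) L.+ ι α L.* x) ≈⟨ L.+-congˡ (L.-‿inverseˡ _) ⟩
      z L.+ L.0#                            ≈⟨ L.+-identityʳ z ⟩
      z                                     ∎)

  -- Multiplication by `e` embeds `V` modulo `V ∩ e ⁻¹′ S` into `L` modulo `S`. This is why the
  -- e-transform adds to `S` as many dimensions as it takes from `V`.
  Free-scale : ∀ e (S V : Sub) {m} {y : Vec L.Carrier m} → All (_∈ Member V) y →
    Free (V ∩ e ⁻¹′ S) y → Free S (Vec.map (e L.*_) y)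
  Free-scale e S V []          _           = tt
  Free-scale e S V (x∈V ∷ y⊆V) (x∉ , free) = x∉ ∘ span-⁻¹′ e S V y⊆V x∈V , Free-scale e S V y⊆V free

  -- From the dimension criterion to a matching

  module _ {n} (A B : Sub) (dimA : RelDim 0ˢ A n) (dimB : RelDim 0ˢ B n) (1∉B : L.1# ∉ Member B) (d : ℕ) where

    B+K : Sub
    B+K = adjoin B L.1#

    1∈B+K : L.1# ∈ Member B+K
    1∈B+K = ∈adjoin B

    dim-B+K : RelDim 0ˢ B+K (suc n)
    dim-B+K = relDim {basis = L.1# ∷ basis} (1∈B+K ∷ All.map (⊆adjoin B) within-Y)
      (1∉B ∘ span-least 0ˢ B (0ˢ⊆ B) within-Y , free)
      (adjoin-least B (span 0ˢ (L.1# ∷ basis)) (⊆adjoin (span 0ˢ basis) ∘ spans) (∈adjoin (span 0ˢ basis)))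
      where open RelDim dimB

    -- The condition of the theorem for `R` containing `1`, where `SR ⊆ S` amounts to `SR = S`;
    -- adding `d` on the right keeps the bound in the natural numbers.
    DimensionCriterion : Set _
    DimensionCriterion = ∀ (S R : Sub) → NonzeroSubspace S → Member S ⊆ Member A → Member R ⊆ Member B+K →
      L.1# ∈ Member R → (∀ {x v} → x ∈ Member S → v ∈ Member R → x L.* v ∈ Member S) →
      ∀ {s q} → RelDim 0ˢ S s → RelDim (B ∩ R) B q → s ≤ q + d

    -- Dyson's e-transform replaces S, V by S + eV, V ∩ e⁻¹S; the dimension
    -- gained by S is lost by V, and SV ⊆ A and 1 ∈ V persist.
    e-transform : DimensionCriterion → ∀ fuel (S V : Sub) {s r} → n ≤ fuel + s →
      RelDim 0ˢ S s → RelDim V B+K r → Member V ⊆ Member B+K → L.1# ∈ Member V →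
      (∀ {x v} → x ∈ Member S → v ∈ Member V → v L.* x ∈ Member A) → s ≤ r + d
    e-transform criterion fuel S V {zero}  n≤ dimS dimV V⊆ 1∈V SV⊆A = z≤n
    e-transform criterion fuel S V {suc s} {r} n≤ dimS dimV V⊆ 1∈V SV⊆A
      with em {∃₂ λ e v → e ∈ Member S × v ∈ Member V × e L.* v ∉ Member S}
    ... | no stable = ℕ.≤-trans
      (criterion S V (RelDim⇒nonzero dimS) S⊆A V⊆ 1∈V closed dimS (proj₂ B/V)) (ℕ.+-monoˡ-≤ d q≤r)
      where
      S⊆A : Member S ⊆ Member A
      S⊆A x∈ = Subspace.respects A (L.*-identityˡ _) (SV⊆A x∈ 1∈V)
      closed : ∀ {x v} → x ∈ Member S → v ∈ Member V → x L.* v ∈ Member S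
      closed {x} {v} x∈ v∈ with em {x L.* v ∈ Member S}
      ... | yes xv∈ = xv∈
      ... | no xv∉  = contradiction (x , v , x∈ , v∈ , xv∉) stable
      B/V : ∃ (RelDim (B ∩ V) B)
      B/V = RelDim-exists (B ∩ V) B dimB (0ˢ⊆ (B ∩ V)) (λ z∈ → z∈)
      -- A basis of `B` over `B ∩ V` stays free over `V` inside `B+K`.
      q≤r : proj₁ B/V ≤ r
      q≤r = steinitz V (RelDim.basis dimV)
        (Free-∩ V B within-Y (Free-anti (V ∩ B) (B ∩ V) basis (λ (z∈V , z∈B) → z∈B , z∈V) free))
        (All.map (RelDim.spans dimV ∘ ⊆adjoin B) within-Y)
        where open RelDim (proj₂ B/V)
    ... | yes (e , v , e∈ , v∈ , ev∉) = step (RelDim-exists V₁ V dim-B+K (0ˢ⊆ V₁) V⊆)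
      where
      V₁ : Sub
      V₁ = V ∩ e ⁻¹′ S
      step : ∃ (RelDim V₁ V) → suc s ≤ r + d
      -- If `V₁` were all of `V`, then `e L.* v` would lie in `S`; hence the transform gains at
      -- least one dimension.
      step (zero , relDim {[]} _ _ spans) = contradiction (proj₂ (spans v∈)) ev∉
      step (suc m , V/V₁@(relDim {y} y⊆ free _)) = ℕ.+-cancelˡ-≤ (suc m) _ _ (begin
        suc m + suc s      ≤⟨ next fuel n≤ ⟩
        (r + suc m) + d    ≡⟨ ≡.cong (_+ d) (ℕ.+-comm r (suc m)) ⟩
        (suc m + r) + d    ≡⟨ ℕ.+-assoc (suc m) r d ⟩
        suc m + (r + d)    ∎)
        where
        open ℕ.≤-Reasoning
        ey : Vec L.Carrier (suc m)
        ey = Vec.map (e L.*_) y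
        S₁ : Sub
        S₁ = span S ey
        -- For a new generator `e L.* u`, commutativity turns `v L.* (e L.* u)` into
        -- `u L.* (e L.* v)`, and `e L.* v` lies in `S` by the definition of `V₁`.
        S₁V₁⊆A : ∀ {x v} → x ∈ Member S₁ → v ∈ Member V₁ → v L.* x ∈ Member A
        S₁V₁⊆A {v = v} x∈ (v∈V , ev∈S) = span-least S (v ⁻¹′ A) (λ x∈S → SV⊆A x∈S v∈V)
          (All.map⁺ (All.map (λ {u} u∈V → Subspace.respects A (x∙yz≈z∙yx u e v) (SV⊆A ev∈S u∈V)) y⊆)) x∈
        -- This is where `e` has to be taken from `S`.
        1∈V₁ : L.1# ∈ Member V₁
        1∈V₁ = 1∈V , Subspace.respects S (L.sym (L.*-identityʳ e)) e∈
        dimS₁ : RelDim 0ˢ S₁ (suc m + suc s)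
        dimS₁ = RelDim-trans (0ˢ⊆ S) (⊆span S ey) dimS
          (relDim (∈span S ey) (Free-scale e S V y⊆ free) (λ z∈ → z∈))
        next : ∀ fuel → n ≤ fuel + suc s → suc m + suc s ≤ (r + suc m) + d
        -- Without fuel `S` already has dimension at least `n`, whereas the larger `S₁` lies in `A`
        -- because `1` is in `V₁`.
        next zero n≤ = contradiction
          (ℕ.≤-trans (RelDim-mono dimS₁ dimA (λ z∈ → z∈)
            (λ x∈ → Subspace.respects A (L.*-identityˡ _) (S₁V₁⊆A x∈ 1∈V₁))) n≤)
          (ℕ.<⇒≱ (s≤s (ℕ.m≤n+m (suc s) m)))
        next (suc fuel) n≤ = e-transform criterion fuel S₁ V₁
          (ℕ.≤-trans n≤ (ℕ.≤-trans (ℕ.≤-reflexive (≡.sym (ℕ.+-suc fuel (suc s))))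
            (ℕ.+-monoʳ-≤ fuel (s≤s (ℕ.m≤n+m (suc s) m)))))
          dimS₁ (RelDim-trans {V₁} proj₁ V⊆ V/V₁ dimV) (V⊆ ∘ proj₁) 1∈V₁ S₁V₁⊆A

    Hall-from-criterion : DimensionCriterion → (a : Vector.Vector L.Carrier n) → (∀ i → a i ∈ Member A) →
      Free 0ˢ (tabulate a) → let open Codimension B dimB in Hall whole (λ i → a i ⁻¹′ A) d
    Hall-from-criterion criterion a a∈A free J = begin
      ∣ J ∣ + codim whole         ≡⟨ ≡.trans (≡.cong (∣ J ∣ +_) codim-whole) (ℕ.+-identityʳ ∣ J ∣) ⟩
      ∣ J ∣                       ≤⟨ e-transform criterion n S V (ℕ.m≤m+n n ∣ J ∣) dimS (proj₂ dimV) proj₁ 1∈V SV⊆A ⟩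
      proj₁ dimV + d              ≤⟨ ℕ.+-monoˡ-≤ d dimV≤ ⟩
      codim U + d                 ≡⟨ ℕ.+-comm (codim U) d ⟩
      d + codim U                 ≤⟨ ℕ.+-monoʳ-≤ d (codim-anti (whole ∩ U) U (λ ((_ , z∈) , _) → z∈)) ⟩
      d + codim (whole ∩ U)       ∎
      where
      open Codimension B dimB
      open ℕ.≤-Reasoning
      S U V : Sub
      S = span 0ˢ (select J a)
      U = ⋂ J (λ i → a i ⁻¹′ A)
      V = B+K ∩ U
      dimS : RelDim 0ˢ S ∣ J ∣
      dimS = relDim (∈span 0ˢ (select J a))
        (Free-select 0ˢ J a (others a) (λ i _ → 0ˢ⊆ (others a i)) (λ i j → ∈others a) (∉others a free)) (λ z∈ → z∈)
      dimV : ∃ (RelDim V B+K)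
      dimV = RelDim-exists V B+K dim-B+K (0ˢ⊆ V) (λ z∈ → z∈)
      1∈V : L.1# ∈ Member V
      1∈V = 1∈B+K , λ i _ → Subspace.respects A (L.sym (L.*-identityʳ (a i))) (a∈A i)
      SV⊆A : ∀ {x v} → x ∈ Member S → v ∈ Member V → v L.* x ∈ Member A
      SV⊆A {v = v} x∈ (_ , v∈U) = span-least 0ˢ (v ⁻¹′ A) (0ˢ⊆ (v ⁻¹′ A))
        (select-All J (λ i i∈ → Subspace.respects A (L.*-comm (a i) v) (v∈U i i∈))) x∈
      -- Since `1` lies in `V`, a basis of `B` over `U ∩ B` spans `B+K` over `V`.
      dimV≤ : proj₁ dimV ≤ codim U
      dimV≤ = steinitz V basis (RelDim.free (proj₂ dimV))
        (All.map (adjoin-least B (span V basis) B⊆ (⊆span V basis 1∈V)) (RelDim.within-Y (proj₂ dimV)))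
        where
        open RelDim (codim-dim U)
        B⊆ : Member B ⊆ Member (span V basis)
        B⊆ z∈ = span-mono (U ∩ B) V basis (λ (z∈U , z∈B) → ⊆adjoin B z∈B , z∈U) (spans z∈)

    -- `rado` encloses `a i ⁻¹′ A`, for `i` in `P`, in independent hyperplanes, and the dual basis
    -- is matched: a vector of `B` in `H i` has no component along `b i`.
    matching : (a : Vector.Vector L.Carrier n) →
      (let open Codimension B dimB in Hall whole (λ i → a i ⁻¹′ A) d) →
      Σ (OrderedBasis B n) λ ℬ → Σ (Subset n) λ P → ∣ P ∣ ≡ n ∸ d ×
        (∀ i → i ∈ᶠ P → ∀ {x} → x ∈ (a i ⁻¹· A) → x ∈ Member B → Span L-space (Others (element B ℬ) i) x)
    matching a hall = ℬ , P , ∣P∣ , matched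
      where
      open Codimension B dimB
      open Hyperplanes (rado n whole (λ i → a i ⁻¹′ A) d hall (ℕ.≤-reflexive (≡.cong (_+ n) codim-whole)))
      dual : ∀ i → ∃[ x ] x ∈ Member B × (∀ j → j ≢ i → x ∈ Member (H j)) × x ∉ Member (H i)
      dual = dual-vector H codim-H (ℕ.≤-trans (ℕ.m≤n+m n (codim whole))
        (ℕ.≤-trans independent (codim-anti (⋂ Subset.⊤ H) (whole ∩ ⋂ Subset.⊤ H) (λ (z∈ , _) → tt , z∈))))
      b : Vector.Vector L.Carrier n
      b i = proj₁ (dual i)
      b∈B : ∀ i → b i ∈ Member B
      b∈B i = proj₁ (proj₂ (dual i))
      b∈H : ∀ i j → j ≢ i → b j ∈ Member (H i)
      b∈H i j j≢i = proj₁ (proj₂ (proj₂ (dual j))) i (j≢i ∘ ≡.sym)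
      b∉H : ∀ i → b i ∉ Member (H i)
      b∉H i = proj₂ (proj₂ (proj₂ (dual i)))
      free : Free 0ˢ (tabulate b)
      free = Free-tabulate 0ˢ b H (λ i → 0ˢ⊆ (H i)) b∈H b∉H
      B⊆ : Member B ⊆ Member (span 0ˢ (tabulate b))
      B⊆ = Basis⇒≤span (tabulate b) dimB (All.tabulate⁺ b∈B) free
      ℬ : OrderedBasis B n
      ℬ = (λ i → b i , b∈B i) , Free⇒OrderedBasis B (λ i → b i , b∈B i) free B⊆
      matched : ∀ i → i ∈ᶠ P → ∀ {x} → x ∈ (a i ⁻¹· A) → x ∈ Member B → Span L-space (Others b i) x
      matched i i∈P {x} (y , u , ay≈1 , u∈A , x≈yu) x∈B =
        others⊆Span b i {Others b i} (λ j j≢i → j , j≢i , L.refl)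
          (∈others-by-separation b i (H i) (b∈H i) (b∉H i) (B⊆ x∈B , U⊆H i i∈P (Subspace.respects A u≈ax u∈A)))
        where
        open SetoidReasoning L.setoid
        u≈ax : u L.≈ a i L.* x
        u≈ax = begin
          u                     ≈⟨ L.*-identityˡ u ⟨
          L.1# L.* u            ≈⟨ L.*-congʳ ay≈1 ⟨
          (a i L.* y) L.* u     ≈⟨ L.*-assoc (a i) y u ⟩
          a i L.* (y L.* u)     ≈⟨ L.*-congˡ x≈yu ⟨
          a i L.* x             ∎

  -- From a matching to the dimension criterion

  -- `RelDim-trans` puts the basis of the smaller subspace last, so these are the positions of a
  -- basis of `S` within the extended basis of `A`.
  suffix : ∀ k s → Subset (k + s)
  suffix zero    s = Subset.⊤
  suffix (suc k) s = outside ∷ suffix k s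

  ∣suffix∣ : ∀ k s → ∣ suffix k s ∣ ≡ s
  ∣suffix∣ zero    s = Subset.∣⊤∣≡n s
  ∣suffix∣ (suc k) s = ∣suffix∣ k s

  lookup-suffix : ∀ {p} {P : L.Carrier → Set p} {k s} (v : Vec L.Carrier k) {u : Vec L.Carrier s} → All P u →
    ∀ i → i ∈ᶠ suffix k s → P (lookup (v ++ u) i)
  lookup-suffix []      Pu i       _          = All.lookup⁺ Pu i
  lookup-suffix (x ∷ v) Pu (suc i) (there i∈) = lookup-suffix v Pu i i∈

  -- Inclusion and exclusion, as `J ∪ P` has at most `n` members; `d ≤ n` makes `n ∸ d` a true
  -- difference.
  overlap-bound : ∀ {n s d} (J P : Subset n) → ∣ J ∣ ≡ s → ∣ P ∣ ≡ n ∸ d → d ≤ n → s ≤ ∣ J ∩ᶠ P ∣ + d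
  overlap-bound {n} {s} {d} J P ∣J∣ ∣P∣ d≤n = ℕ.+-cancelˡ-≤ n _ _ (begin
    n + s                                   ≡⟨ ℕ.+-comm n s ⟩
    s + n                                   ≡⟨ ≡.cong (s +_) (ℕ.m∸n+n≡m d≤n) ⟨
    s + (n ∸ d + d)                         ≡⟨ ℕ.+-assoc s (n ∸ d) d ⟨
    s + (n ∸ d) + d                         ≡⟨ ≡.cong₂ (λ x y → x + y + d) ∣J∣ ∣P∣ ⟨
    ∣ J ∣ + ∣ P ∣ + d                       ≡⟨ ≡.cong (_+ d) (∣∪∣+∣∩∣ J P) ⟨
    ∣ J ∪ P ∣ + ∣ J ∩ᶠ P ∣ + d              ≤⟨ ℕ.+-monoˡ-≤ d (ℕ.+-monoˡ-≤ ∣ J ∩ᶠ P ∣ (Subset.∣p∣≤n (J ∪ P))) ⟩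
    n + ∣ J ∩ᶠ P ∣ + d                      ≡⟨ ℕ.+-assoc n ∣ J ∩ᶠ P ∣ d ⟩
    n + (∣ J ∩ᶠ P ∣ + d)                    ∎)
    where open ℕ.≤-Reasoning

  -- For each `i` in both `J` and `P`, `others b i` contains `B ∩ R` but not `b i`. The `b i` with
  -- these indices are therefore independent modulo `B ∩ R`, and there are at least `s - d` of them.
  matched⇒bound : ∀ n (A B : Sub) d → RelDim 0ˢ A n → d ≤ n → PartiallyMatched n A B d →
    ∀ (S R : Sub) → Member S ⊆ Member A → (∀ {x v} → x ∈ Member S → v ∈ Member R → x L.* v ∈ Member S) →
    ∀ {s q} → RelDim 0ˢ S s → RelDim (B ∩ R) B q → s ≤ q + d
  matched⇒bound n A B d dimA d≤n matched S R S⊆A SR⊆S {s} {q} dimS dimB/R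
    with RelDim-exists S A dimA (0ˢ⊆ S) (λ z∈ → z∈)
  ... | k , dimA/S with RelDim-unique dimA (RelDim-trans (0ˢ⊆ S) S⊆A dimS dimA/S)
  ... | ≡.refl = ℕ.≤-trans (overlap-bound J P (∣suffix∣ k s) ∣P∣ d≤n) (ℕ.+-monoˡ-≤ d Q≤q)
    where
    module S = RelDim dimS
    module A/S = RelDim dimA/S
    𝒜 : OrderedBasis A (k + s)
    𝒜 = RelDim⇒HasDim A (RelDim-trans (0ˢ⊆ S) S⊆A dimS dimA/S)
    a = element A 𝒜
    J : Subset (k + s)
    J = suffix k s
    a∈S : ∀ i → i ∈ᶠ J → a i ∈ Member S
    a∈S = lookup-suffix A/S.basis S.within-Y
    a≉0 : ∀ i → ¬ (a i L.≈ L.0#)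
    a≉0 i aᵢ≈0 = ∉others a (OrderedBasis⇒Free A (proj₁ 𝒜) (proj₂ 𝒜)) i (0ˢ⊆ (others a i) (lift aᵢ≈0))
    ℬ = proj₁ (matched 𝒜)
    b = element B ℬ
    P = proj₁ (proj₂ (matched 𝒜))
    ∣P∣ = proj₁ (proj₂ (proj₂ (matched 𝒜)))
    Span⊆others : ∀ i → Span L-space (Others b i) ⊆ Member (others b i)
    Span⊆others i (r , c , w , w∈ , x≈) = Subspace.respects (others b i) (L.sym x≈)
      (∑-closed (others b i) λ j → let (l , l≢i , w≈b) = w∈ j in
        Subspace.respects (others b i) (L.sym w≈b) (∈others b l≢i))
    B∩R⊆others : ∀ i → i ∈ᶠ J ∩ᶠ P → Member (B ∩ R) ⊆ Member (others b i)
    B∩R⊆others i i∈ {x} (x∈B , x∈R) with Subset.x∈p∩q⁻ J P i∈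
    ... | i∈J , i∈P with Field.inverse L em (a≉0 i)
    ... | y , ya≈1 = Span⊆others i (proj₂ (proj₂ (proj₂ (matched 𝒜))) i i∈P
      -- `x` is the inverse of `a i` times `a i L.* x`, a product that lies in `SR` and hence in
      -- `S`.
      ((y , a i L.* x , L.trans (L.*-comm (a i) y) ya≈1 , S⊆A (SR⊆S (a∈S i i∈J) x∈R) ,
        L.trans (L.sym (L.*-identityˡ x)) (L.trans (L.*-congʳ (L.sym ya≈1)) (L.*-assoc y (a i) x))) , x∈B))
    Q≤q : ∣ J ∩ᶠ P ∣ ≤ q
    Q≤q = steinitz (B ∩ R) basis
      (Free-select (B ∩ R) (J ∩ᶠ P) b (others b) B∩R⊆others (λ i j → ∈others b)
        (∉others b (OrderedBasis⇒Free B (proj₁ ℬ) (proj₂ ℬ))))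
      (select-All (J ∩ᶠ P) (λ i _ → spans (proj₂ (proj₁ ℬ i))))
      where open RelDim dimB/R

-- Integer form of the bound and the equivalence

open import Data.Integer.Base as ℤ using (+_)
import Data.Integer.Properties as ℤ

≤+⇒-≤ : ∀ {s d q} → s ≤ q + d → (+ s) ℤ.- (+ d) ℤ.≤ + q
≤+⇒-≤ {s} {d} {q} s≤ = begin
  (+ s) ℤ.- (+ d)          ≤⟨ ℤ.+-monoˡ-≤ (ℤ.- (+ d)) (ℤ.+≤+ s≤) ⟩
  (+ (q + d)) ℤ.- (+ d)    ≡⟨ ℤ.m-n≡m⊖n (q + d) d ⟩
  (q + d) ℤ.⊖ d            ≡⟨ ℤ.⊖-≥ (ℕ.m≤n+m d q) ⟩
  + (q + d ∸ d)            ≡⟨ ≡.cong +_ (ℕ.m+n∸n≡m q d) ⟩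
  + q                      ∎
  where open ℤ.≤-Reasoning

-≤⇒≤+ : ∀ {s d q} → (+ s) ℤ.- (+ d) ℤ.≤ + q → s ≤ q + d
-≤⇒≤+ {s} {d} {q} s-d≤q with ℕ.≤-total s d
... | inj₁ s≤d = ℕ.≤-trans s≤d (ℕ.m≤n+m d q)
... | inj₂ d≤s = ≡.subst (_≤ q + d) (ℕ.m∸n+n≡m d≤s) (ℕ.+-monoˡ-≤ d (ℤ.drop‿+≤+
  (≡.subst (ℤ._≤ + q) (≡.trans (ℤ.m-n≡m⊖n s d) (ℤ.⊖-≥ d≤s)) s-d≤q)))

theorem3p3 :
    ∀ {c ℓ₁ ℓ₂} → ExcludedMiddle (c ⊔ ℓ₁) →
    (E : FieldExtension c ℓ₁ ℓ₂) →
    let open FieldExtension E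
        open LinearAlgebra K
    in
    IsProper →
    (n : ℕ) → 0 < n →
    (A B : LSubspace) → DimIs A n → DimIs B n → L.1# ∉ Member B →
    (d : ℕ) → d ≤ n →
    PartiallyMatched n A B d ⇔
    ((S R : LSubspace) → NonzeroSubspace S → NonzeroSubspace R →
     Member S ⊆ Member A → Member R ⊆ (B ⊕K) → (S · R) ≐ Member S →
     (s q : ℕ) → DimIs S s → QuotientDimIs B (B ∩ R) q →
     (+ s) ℤ.- (+ d) ℤ.≤ + q)
theorem3p3 em E _ n _ A B dimA dimB 1∉B d d≤n = mk⇔ forward backward
  where
  open FieldExtension E
  open LinearAlgebra K
  open Subspaces K L-space em
  open Matching em E
  dimA′ = HasDim⇒RelDim A dimA
  dimB′ = HasDim⇒RelDim B dimB

  Bound : Set _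
  Bound = (S R : LSubspace) → NonzeroSubspace S → NonzeroSubspace R →
    Member S ⊆ Member A → Member R ⊆ (B ⊕K) → (S · R) ≐ Member S →
    (s q : ℕ) → DimIs S s → QuotientDimIs B (B ∩ R) q → (+ s) ℤ.- (+ d) ℤ.≤ + q

  forward : PartiallyMatched n A B d → Bound
  forward matched S R _ _ S⊆A _ SR≐S s q dimS dimB/R =
    ≤+⇒-≤ (matched⇒bound n A B d dimA′ d≤n matched S R S⊆A
      (λ x∈ v∈ → proj₁ SR≐S (_ , _ , x∈ , v∈ , L.refl))
      (HasDim⇒RelDim S dimS) (HasDim/⇒RelDim B (B ∩ R) dimB/R))

  criterion : Bound → DimensionCriterion A B dimA′ dimB′ 1∉B d
  criterion bound S R S≠0 S⊆A R⊆ 1∈R SR⊆S {s} {q} dimS dimB/R = -≤⇒≤+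
    -- `R` is nonzero because it contains `1`, and `1 ≈ 0` would put `1` into `B`.
    (bound S R S≠0 (L.1# , 1∈R , λ 1≈0 → 1∉B (0ˢ⊆ B (lift 1≈0))) S⊆A
      (λ x∈ → let (u , α , u∈ , x≈) = R⊆ x∈ in u , α , u∈ , L.trans x≈ (L.+-congˡ (L.*-identityʳ (ι α))))
      ((λ (x , v , x∈ , v∈ , y≈) → Subspace.respects S (L.sym y≈) (SR⊆S x∈ v∈)) ,
       -- The inclusion of `S` in `SR` also comes from `1` in `R`.
       (λ {x} x∈ → x , L.1# , x∈ , 1∈R , L.sym (L.*-identityʳ x)))
      s q (RelDim⇒HasDim S dimS) (RelDim⇒HasDim/ B (B ∩ R) dimB/R))

  backward : Bound → PartiallyMatched n A B d
  backward bound 𝒜 =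
    let (ℬ , P , ∣P∣ , matched) = matching A B dimA′ dimB′ 1∉B d (element A 𝒜)
          (Hall-from-criterion A B dimA′ dimB′ 1∉B d (criterion bound) (element A 𝒜) (λ i → proj₂ (proj₁ 𝒜 i))
            (OrderedBasis⇒Free A (proj₁ 𝒜) (proj₂ 𝒜)))
    in ℬ , P , ∣P∣ , λ i i∈P (x∈ , x∈B) → matched i i∈P x∈ x∈B
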